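{- For any positive integer $k$, $$\mathrm{vex}(n,C_{2k+1})\le \sum_{i=\lceil kn/(2k+1)\rceil-\lceil 2(k+1)\log(2k)\rceil}^{n}\binom{n}{i},$$ where $\log$ is the natural logarithm and $C_{2k+1}$ is the cycle of length $2k+1$. Consequently, for fixed $k$, as $n\to\infty$, $2^n-\mathrm{vex}(n,C_{2k+1})=\Theta_k\left(\sum_{i=0}^{\lfloor kn/(2k+1)\rfloor}\binom{n}{i}\right)$.
   Context: The Kneser cube $Kn_n$ is the graph with vertex set $2^{[n]}=\{F: F\subseteq\{1,\dots,n\}\}$ in which two distinct vertices $F,F'$ are adjacent if and only if $F\cap F'=\emptyset$. For a graph $G$, $\mathrm{vex}(n,G)$ is the maximum size of a family $\mathcal{F}\subseteq 2^{[n]}$ such that the induced subgraph $Kn_n[\mathcal{F}]$ contains no subgraph isomorphic to $G$. $\Theta_k$ means the implied constants may depend on $k$. -}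

module Defs where

open import Data.Nat using (ℕ; zero; suc; _+_; _*_; _∸_; _^_; _≤_; _/_; _%_)
open import Data.Nat.Combinatorics using (_C_; _P_)
open import Data.Fin using (Fin; toℕ)
open import Data.Fin.Subset using (Subset; _∩_; Empty)
open import Data.List using (List; map; upTo; length)
open import Data.Nat.ListAction using (sum)
import Data.List.Membership.Propositional as LM
open import Data.List.Relation.Unary.Unique.Propositional using (Unique)
open import Data.Product using (Σ; _×_; ∃)
open import Relation.Binary.PropositionalEquality using (_≡_)
open import Function.Definitions using (Injective)

-- Σ_{i=lo}^{hi} f i   (empty sum if hi < lo)
sumRange : (ℕ → ℕ) → ℕ → ℕ → ℕ
sumRange f lo hi = sum (map (λ i → f (lo + i)) (upTo (suc hi ∸ lo)))

binomSum : ℕ → ℕ → ℕ → ℕ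
binomSum n lo hi = sumRange (λ i → n C i) lo hi

ceilDivSuc : ℕ → ℕ → ℕ
ceilDivSuc a d = (a + d) / suc d

floorDivSuc : ℕ → ℕ → ℕ
floorDivSuc a d = a / suc d

-- "e^m > N" (e = Euler's number): some partial sum Σ_{i≤j} m^i/i! of the
-- exponential series is ≥ N; multiplied through by j!, using j!/i! = j P (j - i).
ExpAtLeast : ℕ → ℕ → Set
ExpAtLeast m N = ∃ λ j → N * (j P j) ≤ sumRange (λ i → (m ^ i) * (j P (j ∸ i))) 0 j

-- m ≥ 2(k+1)·ln(2k)   ⇔   e^m ≥ (2k)^(2(k+1))
LogBound : ℕ → ℕ → Set
LogBound k m = ExpAtLeast m ((2 * k) ^ (2 * (k + 1)))

-- A family of subsets of [n] (vertices of the Kneser cube Kn_n): a duplicate-free list.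
Family : ℕ → Set
Family n = List (Subset n)

-- Kn_n[F] contains a cycle of length L+1 (as a subgraph): distinct members
-- c 0, …, c L of F with c i ∩ c (i+1 mod L+1) = ∅.
ContainsCycle : ∀ {n} → ℕ → Family n → Set
ContainsCycle {n} L F =
  Σ (Fin (suc L) → Subset n) λ c →
    Injective _≡_ _≡_ c
    × (∀ i → c i LM.∈ F)
    × (∀ i j → toℕ j ≡ suc (toℕ i) % suc L → Empty (c i ∩ c j))

OddCycleFree : ∀ {n} → ℕ → Family n → Set
OddCycleFree k F = Unique F × (ContainsCycle (2 * k) F → Data.Empty.⊥)
  where import Data.Empty

{-# OPTIONS --safe #-}
-- Upper bound: if (2k+1)a ≤ kn, cut the circle Z_n into 2k+1 nearly equal parts and take the arcs of
-- length a starting at the cut points.  Visited in steps of k+1 parts, consecutive arcs are disjoint,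
-- so they form a C_{2k+1} in the Kneser cube.  Every permutation of [n] maps this cycle to one that
-- the complement M of F must hit, and averaging over all permutations gives (2k+1) |M_a| ≥ C(n,a)
-- for the a-element sets M_a in M.  For (2k+1)(i+1) ≤ kn the ratio C(n,i+1) / C(n,i) is at least
-- (k+1)/k, and (1+1/k)^m ≥ e^{m/(k+1)} ≥ (2k)² ≥ 2k+1, hence C(n,i) ≤ |M_{i+m}|.
-- Lower bound: each element lies in at most k members of a (2k+1)-cycle, so the sets of size
-- greater than kn/(2k+1) span no such cycle.
module Submission where

open import Defs
open import Data.Nat using (ℕ; zero; suc; pred; _+_; _*_; _∸_; _^_; _≤_; _<_; _/_; _%_; _!; _<ᵇ_; z≤n; s≤s; NonZero; >-nonZero)
open import Data.Nat.Properties
open import Data.Nat.Combinatorics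
open import Data.Nat.Divisibility using (m≤n⇒m!∣n!; n∣m*n)
open import Data.Nat.DivMod
import Data.Nat.ListAction as ListAction
open import Data.Nat.Tactic.RingSolver using (solve-∀)
open import Data.Bool as Bool using (Bool; true; false; not)
import Data.Bool.Properties as Bool
open import Data.Empty using (⊥; ⊥-elim)
open import Data.Fin using (Fin; zero; suc; toℕ; fromℕ<; punchOut)
open import Data.Fin.Properties using (toℕ-fromℕ<; toℕ-injective; toℕ<n; punchIn-punchOut; all?; ¬∀⟶∃¬) renaming (_≟_ to _≟ᶠ_)
open import Data.Fin.Subset as Subset using (Subset; _∩_; Empty)
open import Data.Fin.Subset.Properties using (x∈p∩q⁻; drop-∷-Empty)
open import Data.List as List using (map; applyUpTo; length)
import Data.List.Properties as List
open import Data.List.Membership.Propositional using (_∈_)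
open import Data.List.Membership.Propositional.Properties using (∈-map⁻)
import Data.List.Membership.DecPropositional as DecMembership
import Data.List.Relation.Unary.All as All
import Data.List.Relation.Unary.All.Properties as All
open import Data.List.Relation.Unary.AllPairs using ([]; _∷_)
open import Data.List.Relation.Unary.Any using (here; there)
open import Data.List.Relation.Unary.Unique.Propositional using (Unique)
import Data.List.Relation.Unary.Unique.Propositional.Properties as Unique
open import Data.Product using (_×_; _,_; ∃; ∃₂; proj₁)
open import Data.Sum using (_⊎_; inj₁; inj₂)
open import Data.Unit using (tt)
open import Data.Vec as Vec using (Vec; []; _∷_; lookup) renaming (map to vmap)
open import Data.Vec.Properties as Vec using (lookup-map; []=⇒lookup; ≡-dec)
open import Data.Vec.Functional using (removeAt)
open import Function using (_∘_)
open import Function.Bundles using (Equivalence)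
open import Function.Definitions using (Injective)
open import Relation.Nullary using (yes; no; ¬_; does; Dec)
open import Relation.Binary.Definitions using (tri<; tri≈; tri>)
open import Relation.Binary.PropositionalEquality hiding (J)
open import Algebra.Properties.Semiring.Sum +-*-semiring

-- Finite sums over initial segments of ℕ

sum-mono : ∀ {n} {f g : Fin n → ℕ} → (∀ i → f i ≤ g i) → sum f ≤ sum g
sum-mono {zero} f≤g = z≤n
sum-mono {suc n} f≤g = +-mono-≤ (f≤g zero) (sum-mono (f≤g ∘ suc))

sum-const : ∀ n c → ∑[ i < n ] c ≡ n * c
sum-const zero c = refl
sum-const (suc n) c = cong (c +_) (sum-const n c)

Σ< : ℕ → (ℕ → ℕ) → ℕ
Σ< n f = ∑[ i < n ] f (toℕ i)

Σ<-cong : ∀ n {f g} → (∀ i → i < n → f i ≡ g i) → Σ< n f ≡ Σ< n g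
Σ<-cong zero f≡g = refl
Σ<-cong (suc n) f≡g = cong₂ _+_ (f≡g 0 (s≤s z≤n)) (Σ<-cong n λ i i<n → f≡g (suc i) (s≤s i<n))

Σ<-mono : ∀ n {f g} → (∀ i → i < n → f i ≤ g i) → Σ< n f ≤ Σ< n g
Σ<-mono zero f≤g = z≤n
Σ<-mono (suc n) f≤g = +-mono-≤ (f≤g 0 (s≤s z≤n)) (Σ<-mono n λ i i<n → f≤g (suc i) (s≤s i<n))

Σ<-*ˡ : ∀ n c f → c * Σ< n f ≡ Σ< n (λ i → c * f i)
Σ<-*ˡ n c f = *-distribˡ-sum {n} c (f ∘ toℕ)

Σ<-split : ∀ m n f → Σ< (m + n) f ≡ Σ< m f + Σ< n (λ i → f (m + i))
Σ<-split zero n f = refl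
Σ<-split (suc m) n f = trans (cong (f 0 +_) (Σ<-split m n (f ∘ suc))) (sym (+-assoc (f 0) _ _))

Σ<-snoc : ∀ n f → Σ< (suc n) f ≡ Σ< n f + f n
Σ<-snoc n f = begin
  Σ< (suc n) f                       ≡⟨ cong (λ m → Σ< m f) (+-comm n 1) ⟨
  Σ< (n + 1) f                       ≡⟨ Σ<-split n 1 f ⟩
  Σ< n f + (f (n + 0) + 0)           ≡⟨ cong (Σ< n f +_) (trans (+-identityʳ _) (cong f (+-identityʳ n))) ⟩
  Σ< n f + f n                       ∎
  where open ≡-Reasoning

Σ<-shift : ∀ n f → f n ≡ f 0 → Σ< n (f ∘ suc) ≡ Σ< n f
Σ<-shift n f fn≡f0 = +-cancelˡ-≡ (f 0) _ _ (begin
  f 0 + Σ< n (f ∘ suc)   ≡⟨ Σ<-snoc n f ⟩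
  Σ< n f + f n           ≡⟨ cong (Σ< n f +_) fn≡f0 ⟩
  Σ< n f + f 0           ≡⟨ +-comm _ (f 0) ⟩
  f 0 + Σ< n f           ∎)
  where open ≡-Reasoning

Σ<-prefix : ∀ {m n} f → m ≤ n → Σ< m f ≤ Σ< n f
Σ<-prefix {m} {n} f m≤n = begin
  Σ< m f                                    ≤⟨ m≤m+n _ _ ⟩
  Σ< m f + Σ< (n ∸ m) (λ i → f (m + i))     ≡⟨ Σ<-split m (n ∸ m) f ⟨
  Σ< (m + (n ∸ m)) f                        ≡⟨ cong (λ z → Σ< z f) (m+[n∸m]≡n m≤n) ⟩
  Σ< n f                                    ∎
  where open ≤-Reasoning

Σ<-suffix : ∀ m {n} f → Σ< n (λ i → f (m + i)) ≤ Σ< (m + n) f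
Σ<-suffix m {n} f = ≤-trans (m≤n+m _ (Σ< m f)) (≤-reflexive (sym (Σ<-split m n f)))

sumRange≡Σ< : ∀ f lo hi → sumRange f lo hi ≡ Σ< (suc hi ∸ lo) (λ i → f (lo + i))
sumRange≡Σ< f lo hi = trans (cong ListAction.sum (List.map-upTo (λ i → f (lo + i)) (suc hi ∸ lo))) (go (suc hi ∸ lo) (λ i → f (lo + i)))
  where
  go : ∀ n g → ListAction.sum (applyUpTo g n) ≡ Σ< n g
  go zero g = refl
  go (suc n) g = cong (g 0 +_) (go n (g ∘ suc))

-- The exponential bound

P-suc : ∀ {n k} → k ≤ n → suc n P suc k ≡ suc n * (n P k)
P-suc {n} {k} k≤n = begin
  suc n P suc k              ≡⟨ nPk≡n!/[n∸k]! (s≤s k≤n) ⟩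
  suc n * n ! / (n ∸ k) !    ≡⟨ *-/-assoc (suc n) (m≤n⇒m!∣n! (m∸n≤m n k)) ⟩
  suc n * (n ! / (n ∸ k) !)  ≡⟨ cong (suc n *_) (nPk≡n!/[n∸k]! k≤n) ⟨
  suc n * (n P k)            ∎
  where
  open ≡-Reasoning
  instance _ = (n ∸ k) !≢0

-- j! Σ_{i≤j} m^i / i!
expSum : ℕ → ℕ → ℕ
expSum m j = Σ< (suc j) λ i → m ^ i * (j P (j ∸ i))

expSum-suc : ∀ m j → expSum m (suc j) ≡ suc j * expSum m j + m ^ suc j
expSum-suc m j = begin
  expSum m (suc j)
    ≡⟨ Σ<-snoc (suc j) (λ i → m ^ i * (suc j P (suc j ∸ i))) ⟩
  Σ< (suc j) (λ i → m ^ i * (suc j P (suc j ∸ i))) + m ^ suc j * (suc j P (j ∸ j))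
    ≡⟨ cong₂ _+_ (Σ<-cong (suc j) λ i i≤j → step i (≤-pred i≤j))
                 (trans (cong (λ z → m ^ suc j * (suc j P z)) (n∸n≡0 j)) (*-identityʳ _)) ⟩
  Σ< (suc j) (λ i → suc j * (m ^ i * (j P (j ∸ i)))) + m ^ suc j
    ≡⟨ cong (_+ m ^ suc j) (Σ<-*ˡ (suc j) (suc j) (λ i → m ^ i * (j P (j ∸ i)))) ⟨
  suc j * expSum m j + m ^ suc j ∎
  where
  open ≡-Reasoning
  lem : ∀ a b c → a * (b * c) ≡ b * (a * c)
  lem = solve-∀
  step : ∀ i → i ≤ j → m ^ i * (suc j P (suc j ∸ i)) ≡ suc j * (m ^ i * (j P (j ∸ i)))
  step i i≤j = begin
    m ^ i * (suc j P (suc j ∸ i))   ≡⟨ cong (λ z → m ^ i * (suc j P z)) (+-∸-assoc 1 i≤j) ⟩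
    m ^ i * (suc j P suc (j ∸ i))   ≡⟨ cong (m ^ i *_) (P-suc (m∸n≤m j i)) ⟩
    m ^ i * (suc j * (j P (j ∸ i))) ≡⟨ lem (m ^ i) (suc j) _ ⟩
    suc j * (m ^ i * (j P (j ∸ i))) ∎

-- d^j j! Σ_{i≤j} (M/d)^i / i!
scaledExp : ℕ → ℕ → ℕ → ℕ
scaledExp d zero    M = 1
scaledExp d (suc j) M = suc j * d * scaledExp d j M + M ^ suc j

*-^ : ∀ m d j → (m * d) ^ j ≡ m ^ j * d ^ j
*-^ m d zero = refl
*-^ m d (suc j) = trans (cong (m * d *_) (*-^ m d j)) (lem m d (m ^ j) (d ^ j))
  where
  lem : ∀ m d x y → m * d * (x * y) ≡ m * x * (d * y)
  lem = solve-∀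

scaledExp-expSum : ∀ d m j → scaledExp d j (m * d) ≡ d ^ j * expSum m j
scaledExp-expSum d m zero = refl
scaledExp-expSum d m (suc j) = begin
  suc j * d * scaledExp d j (m * d) + (m * d) ^ suc j
    ≡⟨ cong₂ (λ x y → suc j * d * x + y) (scaledExp-expSum d m j) (*-^ m d (suc j)) ⟩
  suc j * d * (d ^ j * expSum m j) + m ^ suc j * d ^ suc j
    ≡⟨ lem (suc j) d (d ^ j) (expSum m j) (m ^ suc j) ⟩
  d ^ suc j * (suc j * expSum m j + m ^ suc j)
    ≡⟨ cong (d ^ suc j *_) (expSum-suc m j) ⟨
  d ^ suc j * expSum m (suc j) ∎
  where
  open ≡-Reasoning
  lem : ∀ J d x e y → J * d * (x * e) + y * (d * x) ≡ d * x * (J * e + y)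
  lem = solve-∀

-- The mean value estimate for the power `suc j` between `M` and `suc M`, with the derivative taken
-- at the right endpoint. The induction splits one factor `suc M` into `1 + M`.
bernoulli : ∀ M j → suc M ^ suc j ≤ M ^ suc j + suc j * suc M ^ j
bernoulli M zero = ≤-reflexive (lem M)
  where
  lem : ∀ M → suc M * 1 ≡ M * 1 + 1
  lem = solve-∀
bernoulli M (suc j) = begin
  suc M * suc M ^ suc j                                  ≡⟨⟩
  suc M ^ suc j + M * suc M ^ suc j                      ≤⟨ +-monoʳ-≤ _ (*-monoʳ-≤ M (bernoulli M j)) ⟩
  suc M ^ suc j + M * (M ^ suc j + suc j * suc M ^ j)    ≡⟨ lem₁ (suc M ^ suc j) M (M ^ suc j) (suc j) (suc M ^ j) ⟩
  M * M ^ suc j + (suc M ^ suc j + suc j * (M * suc M ^ j))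
    ≤⟨ +-monoʳ-≤ (M * M ^ suc j) (+-monoʳ-≤ (suc M ^ suc j) (*-monoʳ-≤ (suc j) (*-monoˡ-≤ (suc M ^ j) (n≤1+n M)))) ⟩
  M * M ^ suc j + suc (suc j) * suc M ^ suc j ∎
  where
  open ≤-Reasoning
  lem₁ : ∀ a M b J c → a + M * (b + J * c) ≡ M * b + (a + J * (M * c))
  lem₁ = solve-∀

-- With E_j the j-th partial sum of exp: E_{j+1}(x+h) ≤ E_{j+1}(x) + h E_j(x+h) for x = M/d and h = 1/d.
scaledExp-step : ∀ d j M →
  d * scaledExp d (suc j) (suc M) ≤ d * scaledExp d (suc j) M + d * (suc j * scaledExp d j (suc M))
scaledExp-step d zero M = ≤-reflexive (lem d M)
  where
  lem : ∀ d M → d * (1 * d * 1 + suc M * 1) ≡ d * (1 * d * 1 + M * 1) + d * (1 * 1)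
  lem = solve-∀
scaledExp-step d (suc j) M = begin
  d * (J * d * T₁ (suc M) + suc M ^ J)
    ≡⟨ lem₁ d J (T₁ (suc M)) (suc M ^ J) ⟩
  J * d * (d * T₁ (suc M)) + d * suc M ^ J
    ≤⟨ +-mono-≤ (*-monoʳ-≤ (J * d) (scaledExp-step d j M)) (*-monoʳ-≤ d (bernoulli M (suc j))) ⟩
  J * d * (d * T₁ M + d * (suc j * scaledExp d j (suc M))) + d * (M ^ J + J * suc M ^ suc j)
    ≡⟨ lem₂ d J (T₁ M) (suc j) (scaledExp d j (suc M)) (M ^ J) (suc M ^ suc j) ⟩
  d * (J * d * T₁ M + M ^ J) + d * (J * T₁ (suc M)) ∎
  where
  open ≤-Reasoning
  J = suc (suc j)
  T₁ = scaledExp d (suc j)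
  lem₁ : ∀ d J t y → d * (J * d * t + y) ≡ J * d * (d * t) + d * y
  lem₁ = solve-∀
  lem₂ : ∀ d J t i s y z → J * d * (d * t + d * (i * s)) + d * (y + J * z)
         ≡ d * (J * d * t + y) + d * (J * (i * d * s + z))
  lem₂ = solve-∀

-- Put d = k+1 and h = 1/d. Since E_j ≤ E_{j+1}, the previous estimate gives E(x+h) ≤ E(x) + h
-- E(x+h), so (1 - 1/d) E(x+h) ≤ E(x). In other words, each step of length 1/(k+1) multiplies a
-- partial sum of exp by at most (k+1)/k.
scaledExp-decay : ∀ k j M → k * scaledExp (suc k) j (suc M) ≤ suc k * scaledExp (suc k) j M
scaledExp-decay k zero M = *-monoˡ-≤ 1 (n≤1+n k)
scaledExp-decay k (suc j) M = +-cancelˡ-≤ (T (suc M)) _ _ (begin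
  T (suc M) + k * T (suc M)                  ≤⟨ scaledExp-step d j M ⟩
  d * T M + d * (suc j * scaledExp d j (suc M))
    ≤⟨ +-monoʳ-≤ (d * T M) (≤-trans (≤-reflexive (lem d (suc j) _)) (m≤m+n _ (suc M ^ suc j))) ⟩
  d * T M + T (suc M)                        ≡⟨ +-comm (d * T M) _ ⟩
  T (suc M) + d * T M                        ∎)
  where
  open ≤-Reasoning
  d = suc k
  T = scaledExp d (suc j)
  lem : ∀ d J x → d * (J * x) ≡ J * d * x
  lem = solve-∀

scaledExp-bound : ∀ k j M → scaledExp (suc k) j M * k ^ M ≤ suc k ^ M * scaledExp (suc k) j 0
scaledExp-bound k j zero = ≤-reflexive (*-comm _ 1)
scaledExp-bound k j (suc M) = begin
  T (suc M) * (k * k ^ M)      ≡⟨ lem₁ (T (suc M)) k (k ^ M) ⟩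
  k * T (suc M) * k ^ M        ≤⟨ *-monoˡ-≤ (k ^ M) (scaledExp-decay k j M) ⟩
  suc k * T M * k ^ M          ≡⟨ *-assoc (suc k) (T M) (k ^ M) ⟩
  suc k * (T M * k ^ M)        ≤⟨ *-monoʳ-≤ (suc k) (scaledExp-bound k j M) ⟩
  suc k * (suc k ^ M * T 0)    ≡⟨ *-assoc (suc k) (suc k ^ M) (T 0) ⟨
  suc k * suc k ^ M * T 0      ∎
  where
  open ≤-Reasoning
  T = scaledExp (suc k) j
  lem₁ : ∀ t k x → t * (k * x) ≡ k * t * x
  lem₁ = solve-∀

scaledExp-zero : ∀ d j → scaledExp d j 0 ≡ d ^ j * j !
scaledExp-zero d zero = refl
scaledExp-zero d (suc j) = trans (cong (λ x → suc j * d * x + 0) (scaledExp-zero d j)) (lem (suc j) d (d ^ j) (j !))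
  where
  lem : ∀ J d x y → J * d * (x * y) + 0 ≡ d * x * (J * y)
  lem = solve-∀

-- e^m ≤ (1 + 1/k)^(m(k+1))
expAtLeast⇒ : ∀ k m N → ExpAtLeast m N → N * k ^ (m * suc k) ≤ suc k ^ (m * suc k)
expAtLeast⇒ k m N (j , p) = *-cancelʳ-≤ _ _ (d ^ j * j !) {{c≢0}} (begin
  N * k ^ M * (d ^ j * j !)      ≡⟨ lem N (k ^ M) (d ^ j) (j !) ⟩
  d ^ j * (N * j !) * k ^ M      ≤⟨ *-monoˡ-≤ (k ^ M) (*-monoʳ-≤ (d ^ j) p′) ⟩
  d ^ j * expSum m j * k ^ M     ≡⟨ cong (_* k ^ M) (scaledExp-expSum d m j) ⟨
  scaledExp d j M * k ^ M        ≤⟨ scaledExp-bound k j M ⟩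
  d ^ M * scaledExp d j 0        ≡⟨ cong (d ^ M *_) (scaledExp-zero d j) ⟩
  d ^ M * (d ^ j * j !)          ∎)
  where
  open ≤-Reasoning
  d = suc k
  -- The number of steps of length 1/d that lead from 0 to `m`.
  M = m * d
  c≢0 : NonZero (d ^ j * j !)
  c≢0 = m*n≢0 (d ^ j) (j !) {{m^n≢0 d j}} {{j !≢0}}
  p′ : N * j ! ≤ expSum m j
  p′ = subst₂ _≤_ (cong (N *_) (nPn≡n! j)) (sumRange≡Σ< _ 0 j) p
  lem : ∀ N x y z → N * x * (y * z) ≡ y * (N * z) * x
  lem = solve-∀

^-cancelˡ-≤ : ∀ n {a b} → a ^ suc n ≤ b ^ suc n → a ≤ b
^-cancelˡ-≤ n p = ≮⇒≥ λ b<a → <⇒≱ (^-monoˡ-< (suc n) b<a) p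

-- The exponents 2(k+1) and m(k+1) share the factor k+1, so a (k+1)-th root can be taken in
-- `expAtLeast⇒`.
logBound⇒ : ∀ k m → LogBound k m → (2 * k) ^ 2 * k ^ m ≤ suc k ^ m
logBound⇒ k m p = ^-cancelˡ-≤ k (begin
  ((2 * k) ^ 2 * k ^ m) ^ suc k            ≡⟨ *-^ ((2 * k) ^ 2) (k ^ m) (suc k) ⟩
  ((2 * k) ^ 2) ^ suc k * (k ^ m) ^ suc k  ≡⟨ cong₂ _*_ (^-*-assoc (2 * k) 2 (suc k)) (^-*-assoc k m (suc k)) ⟩
  (2 * k) ^ (2 * suc k) * k ^ (m * suc k)  ≡⟨ cong (λ z → (2 * k) ^ (2 * z) * k ^ (m * suc k)) (+-comm k 1) ⟨
  (2 * k) ^ (2 * (k + 1)) * k ^ (m * suc k) ≤⟨ expAtLeast⇒ k m ((2 * k) ^ (2 * (k + 1))) p ⟩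
  suc k ^ (m * suc k)                      ≡⟨ ^-*-assoc (suc k) m (suc k) ⟨
  (suc k ^ m) ^ suc k                      ∎)
  where open ≤-Reasoning

-- This is (1 + 1/k)^m ≤ k/(k-m) with denominators cleared. For each r ≤ k one has 1 + 1/k ≤
-- (r+1)/r, and the product of (r+1)/r over r = k-m, ..., k-1 telescopes.
growth-bound : ∀ m r k → m + r ≡ k → suc k ^ m * r ≤ k ^ suc m
growth-bound zero r .r refl = ≤-reflexive (*-comm 1 r)
growth-bound (suc m) r k eq = begin
  suc k * suc k ^ m * r      ≡⟨ lem₁ (suc k) (suc k ^ m) r ⟩
  suc k ^ m * (suc k * r)    ≤⟨ *-monoʳ-≤ (suc k ^ m) (≤-trans (m≤m+n _ (suc m)) (≤-reflexive base)) ⟩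
  suc k ^ m * (k * suc r)    ≡⟨ lem₂ (suc k ^ m) k (suc r) ⟩
  k * (suc k ^ m * suc r)    ≤⟨ *-monoʳ-≤ k (growth-bound m (suc r) k m+1+r≡k) ⟩
  k * k ^ suc m              ∎
  where
  open ≤-Reasoning
  lem₁ : ∀ x y z → x * y * z ≡ y * (x * z)
  lem₁ = solve-∀
  lem₂ : ∀ x y z → x * (y * z) ≡ y * (x * z)
  lem₂ = solve-∀
  lem₃ : ∀ m r → suc (m + suc r) * r + suc m ≡ (m + suc r) * suc r
  lem₃ = solve-∀
  m+1+r≡k : m + suc r ≡ k
  m+1+r≡k = trans (+-suc m r) eq
  base : suc k * r + suc m ≡ k * suc r
  base = subst (λ k → suc k * r + suc m ≡ k * suc r) m+1+r≡k (lem₃ m r)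

-- For m < k, `growth-bound` gives (k+1)^m ≤ k^(m+1), while `logBound⇒` makes the left side at least
-- 4k² k^m. The bound ensures that every level `i + m` met later has size at least k, which makes it
-- nonempty and forces 2k+1 ≤ n.
logBound⇒k≤m : ∀ k m → 1 ≤ k → LogBound k m → k ≤ m
logBound⇒k≤m k m 1≤k p = ≮⇒≥ λ m<k → <-irrefl refl (begin-strict
  k ^ suc m                 <⟨ *-monoˡ-< (k ^ m) {{m^n≢0 k m}} k<4k² ⟩
  (2 * k) ^ 2 * k ^ m       ≤⟨ logBound⇒ k m p ⟩
  suc k ^ m                 ≡⟨ *-identityʳ _ ⟨
  suc k ^ m * 1             ≤⟨ *-monoʳ-≤ (suc k ^ m) (m<n⇒0<n∸m m<k) ⟩
  suc k ^ m * (k ∸ m)       ≤⟨ growth-bound m (k ∸ m) k (m+[n∸m]≡n (<⇒≤ m<k)) ⟩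
  k ^ suc m                 ∎)
  where
  open ≤-Reasoning
  instance
    k≢0 : NonZero k
    k≢0 = >-nonZero 1≤k
  lem : ∀ k → 2 * k * (2 * k * 1) ≡ k * k + 3 * (k * k)
  lem = solve-∀
  k<4k² : k < (2 * k) ^ 2
  k<4k² = begin-strict
    k                      ≤⟨ m≤m*n k k ⟩
    k * k                  <⟨ m<m+n (k * k) (*-mono-≤ (s≤s {n = 2} z≤n) (*-mono-≤ 1≤k 1≤k)) ⟩
    k * k + 3 * (k * k)    ≡⟨ lem k ⟨
    (2 * k) ^ 2            ∎

-- Growth of binomial coefficients

-- The absorption identity (i+1) C(n,i+1) = (n-i) C(n,i), with the negative term moved to the left
-- so that it also holds for i > n. It follows from Pascal's rule by induction.
C-absorb : ∀ n i → suc i * (n C suc i) + i * (n C i) ≡ n * (n C i)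
C-absorb zero zero = refl
C-absorb zero (suc i) = cong₂ _+_ (*-zeroʳ (suc (suc i))) (*-zeroʳ (suc i))
C-absorb (suc n) zero = trans (cong (λ z → 1 * z + 0) (nC1≡n (suc n))) (lem n)
  where
  lem : ∀ n → 1 * suc n + 0 ≡ suc n * 1
  lem = solve-∀
C-absorb (suc n) (suc i) = begin
  suc (suc i) * (suc n C suc (suc i)) + suc i * (suc n C suc i)
    ≡⟨ cong₂ (λ x y → suc (suc i) * x + suc i * y) (nCk+nC[k+1]≡[n+1]C[k+1] n (suc i)) (nCk+nC[k+1]≡[n+1]C[k+1] n i) ⟨
  suc (suc i) * (B + A) + suc i * (Z + B)
    ≡⟨ lem₁ i A B Z ⟩
  (suc (suc i) * A + suc i * B) + (suc i * B + i * Z) + (B + Z)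
    ≡⟨ cong₂ (λ x y → x + y + (B + Z)) (C-absorb n (suc i)) (C-absorb n i) ⟩
  n * B + n * Z + (B + Z)
    ≡⟨ lem₂ n B Z ⟩
  suc n * (Z + B)
    ≡⟨ cong (suc n *_) (nCk+nC[k+1]≡[n+1]C[k+1] n i) ⟩
  suc n * (suc n C suc i) ∎
  where
  open ≡-Reasoning
  A = n C suc (suc i)
  B = n C suc i
  Z = n C i
  lem₁ : ∀ i A B Z → suc (suc i) * (B + A) + suc i * (Z + B)
       ≡ (suc (suc i) * A + suc i * B) + (suc i * B + i * Z) + (B + Z)
  lem₁ = solve-∀
  lem₂ : ∀ n B Z → n * B + n * Z + (B + Z) ≡ suc n * (Z + B)
  lem₂ = solve-∀

-- By `C-absorb` the ratio of consecutive coefficients is (n-i)/(i+1), and the hypothesis gives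
-- k(n-i) ≥ (2k+1)(i+1) - ki = (k+1)(i+1) + k. The surplus k is the term `k * A` added in the first
-- step.
C-step : ∀ k n i → suc (2 * k) * suc i ≤ k * n → suc k * (n C i) ≤ k * (n C suc i)
C-step k n i p = *-cancelˡ-≤ (suc i) (+-cancelʳ-≤ (k * (i * A)) _ _ (begin
  suc i * (suc k * A) + k * (i * A)    ≤⟨ m≤m+n _ (k * A) ⟩
  suc i * (suc k * A) + k * (i * A) + k * A ≡⟨ lem₁ i k A ⟩
  suc (2 * k) * suc i * A              ≤⟨ *-monoˡ-≤ A p ⟩
  k * n * A                            ≡⟨ *-assoc k n A ⟩
  k * (n * A)                          ≡⟨ cong (k *_) (C-absorb n i) ⟨
  k * (suc i * B + i * A)              ≡⟨ lem₂ k i A B ⟩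
  suc i * (k * B) + k * (i * A)        ∎))
  where
  open ≤-Reasoning
  A = n C i
  B = n C suc i
  lem₁ : ∀ i k A → suc i * (suc k * A) + k * (i * A) + k * A ≡ suc (2 * k) * suc i * A
  lem₁ = solve-∀
  lem₂ : ∀ k i A B → k * (suc i * B + i * A) ≡ suc i * (k * B) + k * (i * A)
  lem₂ = solve-∀

C-growth : ∀ k n i m → suc (2 * k) * (i + m) ≤ k * n → suc k ^ m * (n C i) ≤ k ^ m * (n C (i + m))
C-growth k n i zero p = ≤-reflexive (cong (λ z → 1 * (n C z)) (sym (+-identityʳ i)))
C-growth k n i (suc m) p = begin
  suc k * suc k ^ m * (n C i)     ≡⟨ lem (suc k) (suc k ^ m) (n C i) ⟩
  suc k ^ m * (suc k * (n C i))   ≤⟨ *-monoʳ-≤ (suc k ^ m) (C-step k n i (≤-trans (*-monoʳ-≤ (suc (2 * k)) (≤-trans (m≤m+n (suc i) m) (≤-reflexive (sym (+-suc i m))))) p)) ⟩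
  suc k ^ m * (k * (n C suc i))   ≡⟨ lem′ (suc k ^ m) k (n C suc i) ⟩
  k * (suc k ^ m * (n C suc i))   ≤⟨ *-monoʳ-≤ k (C-growth k n (suc i) m (subst (λ z → suc (2 * k) * z ≤ k * n) (+-suc i m) p)) ⟩
  k * (k ^ m * (n C suc (i + m))) ≡⟨ *-assoc k (k ^ m) _ ⟨
  k ^ suc m * (n C suc (i + m))   ≡⟨ cong (λ z → k ^ suc m * (n C z)) (+-suc i m) ⟨
  k ^ suc m * (n C (i + suc m))   ∎
  where
  open ≤-Reasoning
  lem : ∀ a b c → a * b * c ≡ b * (a * c)
  lem = solve-∀
  lem′ : ∀ a b c → a * (b * c) ≡ b * (a * c)
  lem′ = solve-∀

-- Moving up by `m` levels gains the factor 2k+1 that the averaging argument loses: the total growth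
-- is at least (2k)², which is at least 2k+1 for k ≥ 1.
C-shift : ∀ k n i m → 1 ≤ k → LogBound k m → suc (2 * k) * (i + m) ≤ k * n →
          suc (2 * k) * (n C i) ≤ n C (i + m)
C-shift k n i m 1≤k lb p = *-cancelˡ-≤ (k ^ m) {{m^n≢0 k m}} (begin
  k ^ m * (suc (2 * k) * (n C i))   ≤⟨ *-monoʳ-≤ (k ^ m) (*-monoˡ-≤ (n C i) D≤) ⟩
  k ^ m * ((2 * k) ^ 2 * (n C i))   ≡⟨ lem (k ^ m) ((2 * k) ^ 2) (n C i) ⟩
  (2 * k) ^ 2 * k ^ m * (n C i)     ≤⟨ *-monoˡ-≤ (n C i) (logBound⇒ k m lb) ⟩
  suc k ^ m * (n C i)               ≤⟨ C-growth k n i m p ⟩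
  k ^ m * (n C (i + m))             ∎)
  where
  open ≤-Reasoning
  instance
    k≢0 : NonZero k
    k≢0 = >-nonZero 1≤k
  lem : ∀ a b c → a * (b * c) ≡ b * a * c
  lem = solve-∀
  lem₂ : ∀ k → 2 * k * (2 * k * 1) ≡ k * k + (2 * (k * k) + k * k)
  lem₂ = solve-∀
  D≤ : suc (2 * k) ≤ (2 * k) ^ 2
  D≤ = begin
    suc (2 * k)                     ≤⟨ +-mono-≤ (*-mono-≤ 1≤k 1≤k) (≤-trans (*-monoʳ-≤ 2 (m≤m*n k k)) (m≤m+n _ (k * k))) ⟩
    k * k + (2 * (k * k) + k * k)   ≡⟨ lem₂ k ⟨
    (2 * k) ^ 2                     ∎

-- Averaging over permutations

bit : Bool → ℕ
bit true  = 1
bit false = 0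

bit-not : ∀ b → bit b + bit (not b) ≡ 1
bit-not true  = refl
bit-not false = refl

term≤sum : ∀ {n} (f : Fin n → ℕ) i → f i ≤ sum f
term≤sum {suc n} f i = subst (f i ≤_) (sym (sum-remove {i = i} f)) (m≤m+n (f i) _)

sum-bits : ∀ {n} (b : Fin n → Bool) → ∑[ i < n ] bit (b i) + ∑[ i < n ] bit (not (b i)) ≡ n
sum-bits {n} b = begin
  ∑[ i < n ] bit (b i) + ∑[ i < n ] bit (not (b i)) ≡⟨ ∑-distrib-+ (bit ∘ b) (bit ∘ not ∘ b) ⟨
  ∑[ i < n ] (bit (b i) + bit (not (b i)))          ≡⟨ sum-cong-≗ (bit-not ∘ b) ⟩
  ∑[ i < n ] 1                                      ≡⟨ sum-const n 1 ⟩
  n * 1                                             ≡⟨ *-identityʳ n ⟩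
  n                                                 ∎
  where open ≡-Reasoning

sum-on-bits : ∀ {n} (b : Fin n → Bool) (y : Bool → ℕ) →
  ∑[ i < n ] y (b i) ≡ ∑[ i < n ] bit (b i) * y true + ∑[ i < n ] bit (not (b i)) * y false
sum-on-bits {zero} b y = refl
sum-on-bits {suc n} b y with b zero
... | true  = trans (cong (y true +_) (sum-on-bits (b ∘ suc) y)) (sym (+-assoc (y true) _ _))
... | false = trans (cong (y false +_) (sum-on-bits (b ∘ suc) y)) (lem (y false) (∑[ i < n ] bit (b (suc i)) * y true) (∑[ i < n ] bit (not (b (suc i))) * y false))
  where
  lem : ∀ a b c → a + (b + c) ≡ b + (a + c)
  lem = solve-∀

-- Σ_{|S| = a} f S
levelSum : ∀ n → ℕ → (Subset n → ℕ) → ℕ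
levelSum zero    zero    f = f []
levelSum zero    (suc a) f = 0
levelSum (suc n) zero    f = levelSum n 0 (f ∘ (false ∷_))
levelSum (suc n) (suc a) f = levelSum n a (f ∘ (true ∷_)) + levelSum n (suc a) (f ∘ (false ∷_))

levelSum-empty : ∀ {n a} f → n < a → levelSum n a f ≡ 0
levelSum-empty {zero}  {suc a} f n<a = refl
levelSum-empty {suc n} {suc a} f (s≤s n<a) = cong₂ _+_ (levelSum-empty _ n<a) (levelSum-empty _ (m<n⇒m<1+n n<a))

levelSum-one : ∀ n a → levelSum n a (λ _ → 1) ≡ n C a
levelSum-one zero    zero    = refl
levelSum-one zero    (suc a) = refl
levelSum-one (suc n) zero    = levelSum-one n 0
levelSum-one (suc n) (suc a) = trans (cong₂ _+_ (levelSum-one n a) (levelSum-one n (suc a))) (nCk+nC[k+1]≡[n+1]C[k+1] n a)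

module _ {T : Set} where

  -- Σ of g over the n! orderings of the entries of ts
  arrSum : ∀ n → (Fin n → T) → (Vec T n → ℕ) → ℕ
  arrSum zero    ts g = g []
  arrSum (suc n) ts g = ∑[ j < suc n ] arrSum n (removeAt ts j) (λ w → g (ts j ∷ w))

  -- The property of an ordering that the cycle construction uses: two functions whose images under
  -- `vmap` along `w` agree must then agree at every entry of `ts`.
  _Covers_ : ∀ {m n} → Vec T m → (Fin n → T) → Set
  w Covers ts = ∀ i → ∃ λ x → lookup w x ≡ ts i

  arrSum-mono : ∀ n ts {g g′} → (∀ w → w Covers ts → g w ≤ g′ w) → arrSum n ts g ≤ arrSum n ts g′
  arrSum-mono zero    ts g≤ = g≤ [] λ ()
  arrSum-mono (suc n) ts g≤ = sum-mono λ j → arrSum-mono n (removeAt ts j) λ w cov → g≤ (ts j ∷ w) (extend j w cov)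
    where
    extend : ∀ j w → w Covers removeAt ts j → (ts j ∷ w) Covers ts
    extend j w cov i with j ≟ᶠ i
    ... | yes refl = zero , refl
    ... | no j≢i with cov (punchOut j≢i)
    ...   | x , eq = suc x , trans eq (cong ts (punchIn-punchOut j≢i))

  arrSum-∑ : ∀ n ts {m} (g : Fin m → Vec T n → ℕ) →
    arrSum n ts (λ w → ∑[ i < m ] g i w) ≡ ∑[ i < m ] arrSum n ts (g i)
  arrSum-∑ zero    ts g = refl
  arrSum-∑ (suc n) ts {m} g = trans
    (sum-cong-≗ λ j → arrSum-∑ n (removeAt ts j) (λ i w → g i (ts j ∷ w)))
    (∑-comm λ j i → arrSum n (removeAt ts j) (λ w → g i (ts j ∷ w)))

  -- Call an entry marked if `h` is true on it. A given 0-1 pattern with p ones comes from exactly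
  -- p! q! orderings, because the marked and the unmarked entries can be permuted separately. The
  -- induction sorts the orderings by their first entry: p choices are marked and q are not.
  arrSum-level : (h : T → Bool) → ∀ n ts f {p q} →
    ∑[ i < n ] bit (h (ts i)) ≡ p → ∑[ i < n ] bit (not (h (ts i))) ≡ q →
    arrSum n ts (f ∘ vmap h) ≡ p ! * q ! * levelSum n p f
  arrSum-level h zero    ts f refl refl = sym (+-identityʳ (f []))
  arrSum-level h (suc n) ts f {p} {q} ps qs = begin
    ∑[ j < suc n ] arrSum n (removeAt ts j) (λ w → f (h (ts j) ∷ vmap h w))
      ≡⟨ sum-cong-≗ (λ j → step j (h (ts j)) refl) ⟩
    ∑[ j < suc n ] y (h (ts j))
      ≡⟨ sum-on-bits (h ∘ ts) y ⟩
    ∑[ j < suc n ] bit (h (ts j)) * y true + ∑[ j < suc n ] bit (not (h (ts j))) * y false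
      ≡⟨ cong₂ (λ u v → u * y true + v * y false) ps qs ⟩
    p * y true + q * y false
      ≡⟨ combine p q (trans (sym (cong₂ _+_ ps qs)) (sum-bits (h ∘ ts))) ⟩
    p ! * q ! * levelSum (suc n) p f ∎
    where
    open ≡-Reasoning
    f₁ = f ∘ (true ∷_)
    f₀ = f ∘ (false ∷_)
    -- The contribution of one first entry, according to its mark. The value of `pred` at 0 is
    -- harmless, since the two cases are weighted by `p` and by `q`.
    y′ : ℕ → ℕ → Bool → ℕ
    y′ p q true  = pred p ! * q ! * levelSum n (pred p) f₁
    y′ p q false = p ! * pred q ! * levelSum n p f₀
    y = y′ p q
    rest : ∀ (b : Bool → Bool) j {c} → h (ts j) ≡ c →
      bit (b c) + ∑[ i < n ] bit (b (h (removeAt ts j i))) ≡ ∑[ i < suc n ] bit (b (h (ts i)))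
    rest b j refl = sym (sum-remove {i = j} (λ i → bit (b (h (ts i)))))
    step : ∀ j b → h (ts j) ≡ b → arrSum n (removeAt ts j) (λ w → f (h (ts j) ∷ vmap h w)) ≡ y b
    step j true eq = trans
      (arrSum-level h n (removeAt ts j) (f ∘ (h (ts j) ∷_)) {pred p} {q}
        (cong pred (trans (rest (λ b → b) j eq) ps)) (trans (rest not j eq) qs))
      (cong (λ b → pred p ! * q ! * levelSum n (pred p) (f ∘ (b ∷_))) eq)
    step j false eq = trans
      (arrSum-level h n (removeAt ts j) (f ∘ (h (ts j) ∷_)) {p} {pred q}
        (trans (rest (λ b → b) j eq) ps) (cong pred (trans (rest not j eq) qs)))
      (cong (λ b → p ! * pred q ! * levelSum n p (f ∘ (b ∷_))) eq)
    lem₀ : ∀ u v b → u * (1 * v * b) ≡ 1 * (u * v) * b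
    lem₀ = solve-∀
    lem₁ : ∀ u v a → u * (v * 1 * a) + 0 ≡ u * v * 1 * (a + 0)
    lem₁ = solve-∀
    lem₂ : ∀ u v s t a b → u * (v * (s * t) * a) + s * (u * v * t * b) ≡ u * v * (s * t) * (a + b)
    lem₂ = solve-∀
    combine : ∀ p q → p + q ≡ suc n → p * y′ p q true + q * y′ p q false ≡ p ! * q ! * levelSum (suc n) p f
    combine zero    (suc q) eq = lem₀ (suc q) (q !) _
    -- Without unmarked entries suc p = suc n, and level `suc p` of an n-element set is empty.
    combine (suc p) zero    eq = trans (lem₁ (suc p) (p !) (levelSum n p f₁))
      (cong (λ z → suc p * p ! * 1 * (levelSum n p f₁ + z))
        (sym (levelSum-empty f₀ (≤-reflexive (trans (sym eq) (+-identityʳ (suc p)))))))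
    combine (suc p) (suc q) eq = lem₂ (suc p) (p !) (suc q) (q !) (levelSum n p f₁) (levelSum n (suc p) f₀)

  -- Double counting over the orderings. Each ordering gives L+1 sets of size a that `f` hits at
  -- least once in total, and for each i every a-set arises as the i-th one from the same number a!
  -- (n-a)! of orderings.
  level-density : ∀ {n L a} (ts : Fin n → T) (h : Fin (suc L) → T → Bool) (f : Subset n → ℕ) →
    (∀ i → ∑[ x < n ] bit (h i (ts x)) ≡ a) →
    (∀ w → w Covers ts → 1 ≤ ∑[ i < suc L ] f (vmap (h i) w)) →
    n C a ≤ suc L * levelSum n a f
  level-density {n} {L} {a} ts h f count hit = *-cancelˡ-≤ c {{c≢0}} (begin
    c * (n C a)                                        ≡⟨ cong (c *_) (levelSum-one n a) ⟨
    -- The number of orderings comes from the same count applied to the constant 1, and any index i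
    -- serves.
    c * levelSum n a (λ _ → 1)                         ≡⟨ eval zero (λ _ → 1) ⟨
    arrSum n ts (λ _ → 1)                              ≤⟨ arrSum-mono n ts hit ⟩
    arrSum n ts (λ w → ∑[ i < suc L ] f (vmap (h i) w)) ≡⟨ arrSum-∑ n ts (λ i w → f (vmap (h i) w)) ⟩
    ∑[ i < suc L ] arrSum n ts (f ∘ vmap (h i))        ≡⟨ sum-cong-≗ (λ i → eval i f) ⟩
    ∑[ i < suc L ] (c * levelSum n a f)                ≡⟨ sum-const (suc L) _ ⟩
    suc L * (c * levelSum n a f)                       ≡⟨ lem (suc L) c _ ⟩
    c * (suc L * levelSum n a f)                       ∎)
    where
    open ≤-Reasoning
    c = a ! * (n ∸ a) !
    c≢0 : NonZero c
    c≢0 = a !* (n ∸ a) !≢0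
    lem : ∀ x y z → x * (y * z) ≡ y * (x * z)
    lem = solve-∀
    eval : ∀ i f → arrSum n ts (f ∘ vmap (h i)) ≡ c * levelSum n a f
    eval i f = arrSum-level (h i) n ts f (count i)
      (m+n≡o⇒n≡o∸m (trans (cong (_+ _) (sym (count i))) (sum-bits (h i ∘ ts))))
      where
      m+n≡o⇒n≡o∸m : ∀ {x} → a + x ≡ n → x ≡ n ∸ a
      m+n≡o⇒n≡o∸m {x} refl = sym (m+n∸m≡n a x)

-- Arcs of a circle

[m+n%d]%d≡[m+n]%d : ∀ m n d .{{_ : NonZero d}} → (m + n % d) % d ≡ (m + n) % d
[m+n%d]%d≡[m+n]%d m n d = begin
  (m + n % d) % d            ≡⟨ %-distribˡ-+ m (n % d) d ⟩
  (m % d + n % d % d) % d    ≡⟨ cong (λ z → (m % d + z) % d) (m%n%n≡m%n n d) ⟩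
  (m % d + n % d) % d        ≡⟨ %-distribˡ-+ m n d ⟨
  (m + n) % d                ∎
  where open ≡-Reasoning

[m%d+n]%d≡[m+n]%d : ∀ m n d .{{_ : NonZero d}} → (m % d + n) % d ≡ (m + n) % d
[m%d+n]%d≡[m+n]%d m n d = trans (cong (_% d) (+-comm (m % d) n))
  (trans ([m+n%d]%d≡[m+n]%d n m d) (cong (_% d) (+-comm n m)))

[m*n%d]%d≡[m*n]%d : ∀ m n d .{{_ : NonZero d}} → (m * (n % d)) % d ≡ (m * n) % d
[m*n%d]%d≡[m*n]%d m n d = begin
  (m * (n % d)) % d              ≡⟨ %-distribˡ-* m (n % d) d ⟩
  (m % d * (n % d % d)) % d      ≡⟨ cong (λ z → (m % d * z) % d) (m%n%n≡m%n n d) ⟩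
  (m % d * (n % d)) % d          ≡⟨ %-distribˡ-* m n d ⟨
  (m * n) % d                    ∎
  where open ≡-Reasoning

<ᵇ-true : ∀ {m n} → (m <ᵇ n) ≡ true → m < n
<ᵇ-true {m} {n} eq = <ᵇ⇒< m n (subst Bool.T (sym eq) tt)

true-<ᵇ : ∀ {m n} → m < n → (m <ᵇ n) ≡ true
true-<ᵇ m<n = Equivalence.to Bool.T-≡ (<⇒<ᵇ m<n)

Σ<-below : ∀ {n a} → a ≤ n → Σ< n (λ t → bit (t <ᵇ a)) ≡ a
Σ<-below {zero}  {zero}  z≤n = refl
Σ<-below {suc n} {zero}  z≤n = Σ<-below {n} z≤n
Σ<-below {suc n} {suc a} (s≤s a≤n) = cong suc (Σ<-below a≤n)

module Rotation (n : ℕ) .{{_ : NonZero n}} where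

  Σ<-rotate : ∀ q φ → Σ< n (λ t → φ ((t + q) % n)) ≡ Σ< n φ
  Σ<-rotate zero    φ = Σ<-cong n λ t t<n → cong φ (trans (cong (_% n) (+-identityʳ t)) (m<n⇒m%n≡m t<n))
  Σ<-rotate (suc q) φ = begin
    Σ< n (λ t → φ ((t + suc q) % n))   ≡⟨ Σ<-cong n (λ t _ → cong (λ z → φ (z % n)) (+-suc t q)) ⟩
    Σ< n (λ t → φ ((suc t + q) % n))   ≡⟨ Σ<-shift n (λ t → φ ((t + q) % n)) (cong φ (trans (cong (_% n) (+-comm n q)) ([m+n]%n≡m%n q n))) ⟩
    Σ< n (λ t → φ ((t + q) % n))       ≡⟨ Σ<-rotate q φ ⟩
    Σ< n φ                             ∎
    where open ≡-Reasoning

  module Arcs (a : ℕ) where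

    -- For a ≤ n these are the a consecutive residues that start at -s modulo n. Adding `s` avoids
    -- truncated subtraction, and the reflection of the circle preserves disjointness.
    arc : ℕ → ℕ → Bool
    arc s t = (t + s) % n <ᵇ a

    shift-by : ∀ {s s′} → s ≤ s′ → ∀ t → (t + s′) % n ≡ ((t + s) % n + (s′ ∸ s)) % n
    shift-by {s} {s′} s≤s′ t = begin
      (t + s′) % n                     ≡⟨ cong (λ z → (t + z) % n) (m+[n∸m]≡n s≤s′) ⟨
      (t + (s + (s′ ∸ s))) % n         ≡⟨ cong (_% n) (+-assoc t s _) ⟨
      (t + s + (s′ ∸ s)) % n           ≡⟨ [m%d+n]%d≡[m+n]%d (t + s) _ n ⟨
      ((t + s) % n + (s′ ∸ s)) % n     ∎
      where open ≡-Reasoning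

    -- A point of the first arc has coordinate u < a relative to `s`. Its coordinate relative to
    -- `s′` is u + δ: the upper hypothesis prevents wrapping around, and the lower one gives u + δ ≥
    -- a.
    arc-disjoint : ∀ {s s′} → s + a ≤ s′ → s′ + a ≤ s + n → ∀ t → arc s t ≡ true → arc s′ t ≡ true → ⊥
    arc-disjoint {s} {s′} lo hi t p q = <⇒≱ (<ᵇ-true q) (begin
      a                               ≤⟨ m+n≤o⇒m≤o∸n a (≤-trans (≤-reflexive (+-comm a s)) lo) ⟩
      δ                               ≤⟨ m≤n+m δ u ⟩
      u + δ                           ≡⟨ m<n⇒m%n≡m u+δ<n ⟨
      (u + δ) % n                     ≡⟨ shift-by s≤s′ t ⟨
      (t + s′) % n                    ∎)
      where
      open ≤-Reasoning
      u = (t + s) % n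
      δ = s′ ∸ s
      s≤s′ : s ≤ s′
      s≤s′ = ≤-trans (m≤m+n s a) lo
      u+δ<n : u + δ < n
      u+δ<n = +-cancelˡ-< s _ _ (begin-strict
        s + (u + δ)    <⟨ +-monoʳ-< s (+-monoˡ-< δ (<ᵇ-true p)) ⟩
        s + (a + δ)    ≡⟨ lem s a δ ⟩
        s + δ + a      ≡⟨ cong (_+ a) (m+[n∸m]≡n s≤s′) ⟩
        s′ + a         ≤⟨ hi ⟩
        s + n          ∎)
        where
        lem : ∀ x y z → x + (y + z) ≡ x + z + y
        lem = solve-∀

    -- Each arc is [0, a) in its own coordinate, and the coordinates differ by the rotation by
    -- `s′ ∸ s`. If the arcs coincide, this rotation must map [0, a) into itself.
    arc-moved : ∀ {s s′} → s < s′ → s′ < n → (∀ t → t < n → arc s t ≡ arc s′ t) →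
      ∀ u → u < n → u < a → (u + (s′ ∸ s)) % n < a
    arc-moved {s} {s′} s<s′ s′<n same u u<n u<a = <ᵇ-true (begin
      (u + δ) % n <ᵇ a               ≡⟨ cong (λ z → (z + δ) % n <ᵇ a) at-u ⟨
      ((t + s) % n + δ) % n <ᵇ a     ≡⟨ cong (_<ᵇ a) (shift-by (<⇒≤ s<s′) t) ⟨
      arc s′ t                       ≡⟨ same t (m%n<n _ n) ⟨
      arc s t                        ≡⟨ true-<ᵇ (subst (_< a) (sym at-u) u<a) ⟩
      true                           ∎)
      where
      open ≡-Reasoning
      δ = s′ ∸ s
      -- The point whose coordinate relative to `s` is `u`; here `n ∸ s` plays the part of -s.
      t = (u + (n ∸ s)) % n
      at-u : (t + s) % n ≡ u
      at-u = begin
        (t + s) % n               ≡⟨ [m%d+n]%d≡[m+n]%d (u + (n ∸ s)) s n ⟩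
        (u + (n ∸ s) + s) % n     ≡⟨ cong (_% n) (+-assoc u _ s) ⟩
        (u + (n ∸ s + s)) % n     ≡⟨ cong (λ z → (u + z) % n) (m∸n+n≡m (<⇒≤ (<-trans s<s′ s′<n))) ⟩
        (u + n) % n               ≡⟨ [m+n]%n≡m%n u n ⟩
        u % n                     ≡⟨ m<n⇒m%n≡m u<n ⟩
        u                         ∎

    -- Let δ be the rotation. If a + δ ≤ n, the last point a-1 of [0, a) is carried to a-1+δ ≥ a
    -- without wrapping. Otherwise the image of 0 shows δ < a, whence a + δ ≤ 2a ≤ n, a
    -- contradiction.
    arc-distinct : 1 ≤ a → a + a ≤ n → ∀ {s s′} → s < s′ → s′ < n → ¬ (∀ t → t < n → arc s t ≡ arc s′ t)
    arc-distinct 1≤a 2a≤n {s} {s′} s<s′ s′<n same with a + (s′ ∸ s) ≤? n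
    ... | yes a+δ≤n = <-irrefl refl (begin-strict
      u + δ          ≡⟨ m<n⇒m%n≡m u+δ<n ⟨
      (u + δ) % n    <⟨ arc-moved s<s′ s′<n same u (≤-trans (≤-reflexive suc-u) a≤n) (≤-reflexive suc-u) ⟩
      a              ≡⟨ suc-u ⟨
      suc u          ≡⟨ +-comm u 1 ⟨
      u + 1          ≤⟨ +-monoʳ-≤ u (m<n⇒0<n∸m s<s′) ⟩
      u + δ          ∎)
      where
      open ≤-Reasoning
      δ = s′ ∸ s
      u = pred a
      suc-u : suc u ≡ a
      suc-u = suc-pred a {{>-nonZero 1≤a}}
      a≤n : a ≤ n
      a≤n = ≤-trans (m≤m+n a a) 2a≤n
      u+δ<n : u + δ < n
      u+δ<n = subst (λ z → z + δ ≤ n) (sym suc-u) a+δ≤n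
    ... | no a+δ≰n = a+δ≰n (≤-trans (+-monoʳ-≤ a (<⇒≤ δ<a)) 2a≤n)
      where
      δ<a : s′ ∸ s < a
      δ<a = subst (_< a) (m<n⇒m%n≡m (≤-<-trans (m∸n≤m s′ s) s′<n))
        (arc-moved s<s′ s′<n same 0 (≤-trans 1≤a (≤-trans (m≤m+n a a) 2a≤n)) 1≤a)

-- D = 2k + 1 is kept abstract so that _/_ and _%_ by D do not unfold.
module Positions (k n a D : ℕ) .{{_ : NonZero D}} (D≡2k+1 : D ≡ suc (2 * k)) (D≤n : D ≤ n) (Da≤kn : D * a ≤ k * n) where

  pos : ℕ → ℕ
  pos r = r * n / D

  -- Adding c outside the floor equals adding cD inside it, so comparisons of shifted cut points
  -- reduce to linear inequalities.
  pos-shift : ∀ r c r′ c′ → r * n + c * D ≤ r′ * n + c′ * D → pos r + c ≤ pos r′ + c′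
  pos-shift r c r′ c′ p = subst₂ _≤_ (eval r c) (eval r′ c′) (/-monoˡ-≤ D p)
    where
    eval : ∀ r c → (r * n + c * D) / D ≡ pos r + c
    eval r c = trans (+-distrib-/-∣ʳ (r * n) (n∣m*n c)) (cong (pos r +_) (m*n/n≡m c D))

  pos-< : ∀ {r r′} → r < r′ → pos r < pos r′
  pos-< {r} {r′} r<r′ = subst₂ _≤_ (+-comm (pos r) 1) (+-identityʳ _) (pos-shift r 1 r′ 0 (begin
    r * n + 1 * D       ≤⟨ +-monoʳ-≤ (r * n) (≤-trans (≤-reflexive (*-identityˡ D)) D≤n) ⟩
    r * n + n           ≡⟨ +-comm (r * n) n ⟩
    suc r * n           ≤⟨ *-monoˡ-≤ n r<r′ ⟩
    r′ * n              ≡⟨ +-identityʳ _ ⟨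
    r′ * n + 0 * D      ∎))
    where open ≤-Reasoning

  pos<n : ∀ {r} → r < D → pos r < n
  pos<n {r} r<D = m<n*o⇒m/o<n (subst (r * n <_) (*-comm D n) (*-monoˡ-< n {{>-nonZero (≤-trans (≤-trans (s≤s z≤n) r<D) D≤n)}} r<D))

  -- The two hypotheses of `arc-disjoint`: a distance of at least `a` in both directions around the
  -- circle.
  Apart : ℕ → ℕ → Set
  Apart s s′ = s + a ≤ s′ × s′ + a ≤ s + n

  aD≤kn : a * D ≤ k * n
  aD≤kn = subst (_≤ k * n) (*-comm D a) Da≤kn

  nD≡kn+kn+n : n * D ≡ k * n + k * n + n
  nD≡kn+kn+n = trans (cong (n *_) D≡2k+1) (lem n k)
    where
    lem : ∀ n k → n * suc (2 * k) ≡ k * n + k * n + n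
    lem = solve-∀

  -- The two cut points are k parts apart one way round and k+1 parts the other way, and aD ≤ kn
  -- says that k parts already have average total length at least a. In `apart-k+1` the two ways are
  -- exchanged.
  apart-k : ∀ r → Apart (pos r) (pos (k + r))
  apart-k r =
    subst (pos r + a ≤_) (+-identityʳ _) (pos-shift r a (k + r) 0
      (≤-trans (+-monoʳ-≤ (r * n) aD≤kn) (≤-reflexive (lem₁ r k n D)))) ,
    pos-shift (k + r) a r n (≤-trans (+-monoʳ-≤ ((k + r) * n) aD≤kn) (≤-trans (m≤m+n _ n) (≤-reflexive (trans (lem₂ r k n) (cong (r * n +_) (sym nD≡kn+kn+n))))))
    where
    lem₁ : ∀ r k n D → r * n + k * n ≡ (k + r) * n + 0 * D
    lem₁ = solve-∀
    lem₂ : ∀ r k n → (k + r) * n + k * n + n ≡ r * n + (k * n + k * n + n)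
    lem₂ = solve-∀

  apart-k+1 : ∀ r → Apart (pos r) (pos (suc k + r))
  apart-k+1 r =
    subst (pos r + a ≤_) (+-identityʳ _) (pos-shift r a (suc k + r) 0
      (≤-trans (+-monoʳ-≤ (r * n) aD≤kn) (≤-trans (m≤m+n _ n) (≤-reflexive (lem₁ r k n D))))) ,
    pos-shift (suc k + r) a r n (≤-trans (+-monoʳ-≤ ((suc k + r) * n) aD≤kn) (≤-reflexive (trans (lem₂ r k n) (cong (r * n +_) (sym nD≡kn+kn+n)))))
    where
    lem₁ : ∀ r k n D → r * n + k * n + n ≡ (suc k + r) * n + 0 * D
    lem₁ = solve-∀
    lem₂ : ∀ r k n → (suc k + r) * n + k * n ≡ r * n + (k * n + k * n + n)
    lem₂ = solve-∀

  ρ : ℕ → ℕ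
  ρ i = (i * suc k) % D

  -- 2(k + 1) ≡ 1 modulo 2k + 1
  ρ-inverse : ∀ {i} → i < D → (2 * ρ i) % D ≡ i
  ρ-inverse {i} i<D = begin
    (2 * ρ i) % D          ≡⟨ [m*n%d]%d≡[m*n]%d 2 (i * suc k) D ⟩
    (2 * (i * suc k)) % D  ≡⟨ cong (_% D) (trans (lem i k) (cong (λ d → i + i * d) (sym D≡2k+1))) ⟩
    (i + i * D) % D        ≡⟨ [m+kn]%n≡m%n i i D ⟩
    i % D                  ≡⟨ m<n⇒m%n≡m i<D ⟩
    i                      ∎
    where
    open ≡-Reasoning
    lem : ∀ i k → 2 * (i * suc k) ≡ i + i * suc (2 * k)
    lem = solve-∀

  ρ-injective : ∀ {i j} → i < D → j < D → ρ i ≡ ρ j → i ≡ j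
  ρ-injective i<D j<D eq = trans (sym (ρ-inverse i<D)) (trans (cong (λ r → (2 * r) % D) eq) (ρ-inverse j<D))

  ρ-suc : ∀ i → ρ (suc i % D) ≡ (suc k + ρ i) % D
  ρ-suc i = begin
    (suc i % D * suc k) % D     ≡⟨ cong (_% D) (*-comm (suc i % D) (suc k)) ⟩
    (suc k * (suc i % D)) % D   ≡⟨ [m*n%d]%d≡[m*n]%d (suc k) (suc i) D ⟩
    (suc k * suc i) % D         ≡⟨ cong (_% D) (*-comm (suc k) (suc i)) ⟩
    (suc k + i * suc k) % D     ≡⟨ [m+n%d]%d≡[m+n]%d (suc k) (i * suc k) D ⟨
    (suc k + ρ i) % D           ∎
    where open ≡-Reasoning

  -- If advancing by k+1 does not pass D, `apart-k+1` applies. If it does, the new index is x = ρ i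
  -- - k, so the old cut point lies k parts after the new one and `apart-k` applies from x.
  apart-suc : ∀ i → Apart (pos (ρ i)) (pos (ρ (suc i % D))) ⊎ Apart (pos (ρ (suc i % D))) (pos (ρ i))
  apart-suc i with suc k + ρ i <? D
  ... | yes lt = inj₁ (subst (Apart (pos (ρ i)) ∘ pos) (sym (trans (ρ-suc i) (m<n⇒m%n≡m lt))) (apart-k+1 (ρ i)))
  ... | no ≥D = inj₂ (subst₂ (λ r r′ → Apart (pos r) (pos r′)) (sym eq) k+x (apart-k x))
    where
    x = suc k + ρ i ∸ D
    D+x : D + x ≡ suc k + ρ i
    D+x = m+[n∸m]≡n (≮⇒≥ ≥D)
    k+x : k + x ≡ ρ i
    k+x = +-cancelˡ-≡ (suc k) _ _ (trans (lem k x) (trans (cong (_+ x) (sym D≡2k+1)) D+x))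
      where
      lem : ∀ k x → suc k + (k + x) ≡ suc (2 * k) + x
      lem = solve-∀
    x<D : x < D
    x<D = ≤-<-trans (≤-trans (m≤n+m x k) (≤-reflexive k+x)) (m%n<n _ D)
    eq : ρ (suc i % D) ≡ x
    eq = begin
      ρ (suc i % D)       ≡⟨ ρ-suc i ⟩
      (suc k + ρ i) % D   ≡⟨ cong (_% D) (trans (sym D+x) (+-comm D x)) ⟩
      (x + D) % D         ≡⟨ [m+n]%n≡m%n x D ⟩
      x % D               ≡⟨ m<n⇒m%n≡m x<D ⟩
      x                   ∎
      where open ≡-Reasoning

  pos-injective : ∀ {r r′} → pos r ≡ pos r′ → r ≡ r′
  pos-injective {r} {r′} eq with <-cmp r r′
  ... | tri< r<r′ _ _ = ⊥-elim (<-irrefl eq (pos-< r<r′))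
  ... | tri≈ _ r≡r′ _ = r≡r′
  ... | tri> _ _ r>r′ = ⊥-elim (<-irrefl (sym eq) (pos-< r>r′))

-- Families and their complements

subsetSum : ∀ n → (Subset n → ℕ) → ℕ
subsetSum zero    f = f []
subsetSum (suc n) f = subsetSum n (f ∘ (true ∷_)) + subsetSum n (f ∘ (false ∷_))

subsetSum≡Σlevel : ∀ n f → subsetSum n f ≡ Σ< (suc n) (λ a → levelSum n a f)
subsetSum≡Σlevel zero    f = sym (+-identityʳ (f []))
subsetSum≡Σlevel (suc n) f = begin
  subsetSum n f₁ + subsetSum n f₀
    ≡⟨ cong₂ _+_ (subsetSum≡Σlevel n f₁) (subsetSum≡Σlevel n f₀) ⟩
  Σ< (suc n) l₁ + Σ< (suc n) l₀
    ≡⟨ cong (Σ< (suc n) l₁ +_) (trans (Σ<-snoc (suc n) l₀) (trans (cong (Σ< (suc n) l₀ +_) (levelSum-empty f₀ ≤-refl)) (+-identityʳ _))) ⟨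
  Σ< (suc n) l₁ + (l₀ 0 + Σ< (suc n) (l₀ ∘ suc))
    ≡⟨ lem (Σ< (suc n) l₁) (l₀ 0) _ ⟩
  l₀ 0 + (Σ< (suc n) l₁ + Σ< (suc n) (l₀ ∘ suc))
    ≡⟨ cong (l₀ 0 +_) (∑-distrib-+ {suc n} (l₁ ∘ toℕ) (l₀ ∘ suc ∘ toℕ)) ⟨
  l₀ 0 + Σ< (suc n) (λ a → l₁ a + l₀ (suc a)) ∎
  where
  open ≡-Reasoning
  f₁ = f ∘ (true ∷_)
  f₀ = f ∘ (false ∷_)
  l₁ = λ a → levelSum n a f₁
  l₀ = λ a → levelSum n a f₀
  lem : ∀ x y z → x + (y + z) ≡ y + (x + z)
  lem = solve-∀

subsetSum-+ : ∀ n f g → subsetSum n (λ S → f S + g S) ≡ subsetSum n f + subsetSum n g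
subsetSum-+ zero    f g = refl
subsetSum-+ (suc n) f g = trans
  (cong₂ _+_ (subsetSum-+ n (f ∘ (true ∷_)) (g ∘ (true ∷_))) (subsetSum-+ n (f ∘ (false ∷_)) (g ∘ (false ∷_))))
  (lem (subsetSum n (f ∘ (true ∷_))) (subsetSum n (g ∘ (true ∷_))) (subsetSum n (f ∘ (false ∷_))) (subsetSum n (g ∘ (false ∷_))))
  where
  lem : ∀ a b c d → (a + b) + (c + d) ≡ (a + c) + (b + d)
  lem = solve-∀

subsetSum-mono : ∀ n {f g} → (∀ S → f S ≤ g S) → subsetSum n f ≤ subsetSum n g
subsetSum-mono zero    f≤g = f≤g []
subsetSum-mono (suc n) f≤g = +-mono-≤ (subsetSum-mono n (f≤g ∘ (true ∷_))) (subsetSum-mono n (f≤g ∘ (false ∷_)))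

subsetSum-one : ∀ n → subsetSum n (λ _ → 1) ≡ 2 ^ n
subsetSum-one zero    = refl
subsetSum-one (suc n) = cong₂ _+_ (subsetSum-one n) (trans (subsetSum-one n) (sym (+-identityʳ (2 ^ n))))

term≤subsetSum : ∀ {n} f (S : Subset n) → f S ≤ subsetSum n f
term≤subsetSum f []          = ≤-refl
term≤subsetSum f (true ∷ S)  = ≤-trans (term≤subsetSum (f ∘ (true ∷_)) S) (m≤m+n _ _)
term≤subsetSum f (false ∷ S) = ≤-trans (term≤subsetSum (f ∘ (false ∷_)) S) (m≤n+m _ _)

Σ<-C : ∀ n → Σ< (suc n) (n C_) ≡ 2 ^ n
Σ<-C n = begin
  Σ< (suc n) (n C_)                          ≡⟨ Σ<-cong (suc n) (λ a _ → levelSum-one n a) ⟨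
  Σ< (suc n) (λ a → levelSum n a (λ _ → 1))  ≡⟨ subsetSum≡Σlevel n (λ _ → 1) ⟨
  subsetSum n (λ _ → 1)                      ≡⟨ subsetSum-one n ⟩
  2 ^ n                                      ∎
  where open ≡-Reasoning

_≟ˢ_ : ∀ {n} (S S′ : Subset n) → Dec (S ≡ S′)
_≟ˢ_ = ≡-dec Bool._≟_

multiplicity : ∀ {n} → Family n → Subset n → ℕ
multiplicity List.[]       S = 0
multiplicity (S′ List.∷ F) S = bit (does (S′ ≟ˢ S)) + multiplicity F S

-- The indicator function of the complement of `F`.
missing : ∀ {n} → Family n → Subset n → ℕ
missing F S = 1 ∸ multiplicity F S

multiplicity-∉ : ∀ {n} (F : Family n) S → ¬ (S ∈ F) → multiplicity F S ≡ 0
multiplicity-∉ List.[]       S S∉F = refl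
multiplicity-∉ (S′ List.∷ F) S S∉F with S′ ≟ˢ S
... | yes S′≡S = ⊥-elim (S∉F (here (sym S′≡S)))
... | no  _    = multiplicity-∉ F S (S∉F ∘ there)

multiplicity≤1 : ∀ {n} {F : Family n} → Unique F → ∀ S → multiplicity F S ≤ 1
multiplicity≤1 []                       S = z≤n
multiplicity≤1 {F = S′ List.∷ F} u@(_ ∷ uF) S with S′ ≟ˢ S
... | yes refl = ≤-reflexive (cong suc (multiplicity-∉ F S (Unique.Unique[x∷xs]⇒x∉xs u)))
... | no  _    = multiplicity≤1 uF S

length≤multiplicity : ∀ {n} (F : Family n) → length F ≤ subsetSum n (multiplicity F)
length≤multiplicity List.[]      = z≤n
length≤multiplicity {n} (S List.∷ F) = begin
  1 + length F
    ≤⟨ +-mono-≤ (subst (_≤ subsetSum n (λ S′ → bit (does (S ≟ˢ S′)))) self (term≤subsetSum (λ S′ → bit (does (S ≟ˢ S′))) S)) (length≤multiplicity F) ⟩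
  subsetSum n (λ S′ → bit (does (S ≟ˢ S′))) + subsetSum n (multiplicity F)
    ≡⟨ subsetSum-+ n (λ S′ → bit (does (S ≟ˢ S′))) (multiplicity F) ⟨
  subsetSum n (multiplicity (S List.∷ F)) ∎
  where
  open ≤-Reasoning
  self : bit (does (S ≟ˢ S)) ≡ 1
  self with S ≟ˢ S
  ... | yes _  = refl
  ... | no S≢S = ⊥-elim (S≢S refl)

length+missing≤ : ∀ {n} {F : Family n} → Unique F →
  length F + Σ< (suc n) (λ a → levelSum n a (missing F)) ≤ 2 ^ n
length+missing≤ {n} {F} u = begin
  length F + Σ< (suc n) (λ a → levelSum n a (missing F))  ≡⟨ cong (length F +_) (subsetSum≡Σlevel n (missing F)) ⟨
  length F + subsetSum n (missing F)                      ≤⟨ +-monoˡ-≤ _ (length≤multiplicity F) ⟩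
  subsetSum n (multiplicity F) + subsetSum n (missing F)  ≡⟨ subsetSum-+ n (multiplicity F) (missing F) ⟨
  subsetSum n (λ S → multiplicity F S + missing F S)      ≤⟨ subsetSum-mono n (λ S → ≤-reflexive (m+[n∸m]≡n (multiplicity≤1 u S))) ⟩
  subsetSum n (λ _ → 1)                                   ≡⟨ subsetSum-one n ⟩
  2 ^ n                                                   ∎
  where open ≤-Reasoning

-- An ordering `w` places the elements of [n] on the circle, and `c i` collects those that fall on
-- the i-th arc. These sets form a cycle of length 2k+1, so one of them is outside `F`, and
-- `level-density` averages this over all orderings.
level-missing : ∀ {n k a} (F : Family n) → OddCycleFree k F → 1 ≤ k → 1 ≤ a →
  suc (2 * k) ≤ n → suc (2 * k) * a ≤ k * n → n C a ≤ suc (2 * k) * levelSum n a (missing F)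
level-missing {n} {k} {a} F (_ , free) 1≤k 1≤a D≤n Da≤kn = level-density toℕ (λ i → arc (s i)) (missing F)
  (λ i → trans (Σ<-rotate (s i) (λ t → bit (t <ᵇ a))) (Σ<-below a≤n)) hit
  where
  open Positions k n a (suc (2 * k)) refl D≤n Da≤kn
  instance
    n≢0 : NonZero n
    n≢0 = >-nonZero (≤-trans (s≤s z≤n) D≤n)
    k≢0 : NonZero k
    k≢0 = >-nonZero 1≤k
  open Rotation n
  open Arcs a
  open DecMembership (_≟ˢ_ {n}) using (_∈?_)
  s : Fin (suc (2 * k)) → ℕ
  s i = pos (ρ (toℕ i))
  2a≤n : a + a ≤ n
  2a≤n = *-cancelˡ-≤ k (≤-trans (≤-trans (≤-reflexive (lem k a)) (m≤n+m _ a)) Da≤kn)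
    where
    lem : ∀ k a → k * (a + a) ≡ 2 * k * a
    lem = solve-∀
  a≤n : a ≤ n
  a≤n = ≤-trans (m≤m+n a a) 2a≤n
  s<n : ∀ i → s i < n
  s<n i = pos<n (m%n<n (toℕ i * suc k) (suc (2 * k)))

  module _ (w : Vec ℕ n) (cov : w Covers toℕ {n}) where
    c : Fin (suc (2 * k)) → Subset n
    c i = vmap (arc (s i)) w

    agree : ∀ i j → c i ≡ c j → ∀ t → t < n → arc (s i) t ≡ arc (s j) t
    agree i j eq t t<n with cov (fromℕ< t<n)
    ... | x , wx = subst (λ t → arc (s i) t ≡ arc (s j) t) (trans wx (toℕ-fromℕ< t<n))
      (trans (sym (lookup-map x (arc (s i)) w)) (trans (cong (λ S → lookup S x) eq) (lookup-map x (arc (s j)) w)))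

    c-injective : Injective _≡_ _≡_ c
    c-injective {i} {j} eq with <-cmp (s i) (s j)
    ... | tri< lt _ _ = ⊥-elim (arc-distinct 1≤a 2a≤n lt (s<n j) (agree i j eq))
    ... | tri≈ _ e _  = toℕ-injective (ρ-injective (toℕ<n i) (toℕ<n j) (pos-injective e))
    ... | tri> _ _ gt = ⊥-elim (arc-distinct 1≤a 2a≤n gt (s<n i) (agree j i (sym eq)))

    c-disjoint : ∀ i j → toℕ j ≡ suc (toℕ i) % suc (2 * k) → Empty (c i ∩ c j)
    c-disjoint i j eq (x , x∈) with x∈p∩q⁻ (c i) (c j) x∈
    ... | x∈ci , x∈cj = clash (apart-suc (toℕ i))
      where
      member : ∀ i → x Subset.∈ c i → arc (s i) (lookup w x) ≡ true
      member i x∈ = trans (sym (lookup-map x (arc (s i)) w)) ([]=⇒lookup x∈)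
      clash : Apart (s i) (pos (ρ (suc (toℕ i) % suc (2 * k)))) ⊎ Apart (pos (ρ (suc (toℕ i) % suc (2 * k)))) (s i) → ⊥
      clash rewrite sym eq = λ where
        (inj₁ (lo , hi)) → arc-disjoint lo hi (lookup w x) (member i x∈ci) (member j x∈cj)
        (inj₂ (lo , hi)) → arc-disjoint lo hi (lookup w x) (member j x∈cj) (member i x∈ci)

    hit : 1 ≤ ∑[ i < suc (2 * k) ] missing F (c i)
    hit with all? (λ i → c i ∈? F)
    ... | yes c∈F = ⊥-elim (free (c , c-injective , c∈F , c-disjoint))
    ... | no ¬c∈F with ¬∀⟶∃¬ _ _ (λ i → c i ∈? F) ¬c∈F
    ...   | i , ci∉F = subst (λ z → 1 ∸ z ≤ _) (multiplicity-∉ F (c i) ci∉F) (term≤sum (missing F ∘ c) i)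

-- Odd cycles of large sets

-- Summing over the 2k+1 cyclically adjacent pairs counts every one twice, so 2s ≤ 2k+1 and by
-- parity s ≤ k.
odd-cycle-bits : ∀ k (b : ℕ → Bool) → b (suc (2 * k)) ≡ b 0 → (∀ i → bit (b i) + bit (b (suc i)) ≤ 1) →
  Σ< (suc (2 * k)) (bit ∘ b) ≤ k
odd-cycle-bits k b per adj = ≮⇒≥ λ k<s → <⇒≱ (doubled-< k<s) (begin
  s + s                                    ≡⟨ cong (s +_) (Σ<-shift D (bit ∘ b) (cong bit per)) ⟨
  s + Σ< D (bit ∘ b ∘ suc)                 ≡⟨ ∑-distrib-+ {D} (bit ∘ b ∘ toℕ) (bit ∘ b ∘ suc ∘ toℕ) ⟨
  Σ< D (λ i → bit (b i) + bit (b (suc i))) ≤⟨ Σ<-mono D (λ i _ → adj i) ⟩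
  Σ< D (λ _ → 1)                           ≡⟨ sum-const D 1 ⟩
  D * 1                                    ≡⟨ *-identityʳ D ⟩
  D                                        ∎)
  where
  open ≤-Reasoning
  D = suc (2 * k)
  s = Σ< D (bit ∘ b)
  lem : ∀ k → suc (suc (2 * k)) ≡ suc k + suc k
  lem = solve-∀
  doubled-< : k < s → D < s + s
  doubled-< k<s = ≤-trans (≤-reflexive (lem k)) (+-mono-≤ k<s k<s)

∣∣-split : ∀ {n} (S : Subset (suc n)) → Subset.∣ S ∣ ≡ bit (Vec.head S) + Subset.∣ Vec.tail S ∣
∣∣-split (true ∷ S)  = refl
∣∣-split (false ∷ S) = refl

disjoint-heads : ∀ {n} (S S′ : Subset (suc n)) → Empty (S ∩ S′) → bit (Vec.head S) + bit (Vec.head S′) ≤ 1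
disjoint-heads (true ∷ S)  (true ∷ S′)  e = ⊥-elim (e (zero , Vec.here))
disjoint-heads (true ∷ S)  (false ∷ S′) e = ≤-refl
disjoint-heads (false ∷ S) (true ∷ S′)  e = ≤-refl
disjoint-heads (false ∷ S) (false ∷ S′) e = z≤n

disjoint-tails : ∀ {n} (S S′ : Subset (suc n)) → Empty (S ∩ S′) → Empty (Vec.tail S ∩ Vec.tail S′)
disjoint-tails (_ ∷ S) (_ ∷ S′) = drop-∷-Empty

-- Incidences are counted element by element: the heads record which sets contain the first element,
-- and at most k do. Indexing by ℕ with one closing equation keeps modular arithmetic out of the
-- induction.
odd-cycle-sizes : ∀ n k (c : ℕ → Subset n) → c (suc (2 * k)) ≡ c 0 → (∀ i → Empty (c i ∩ c (suc i))) →
  Σ< (suc (2 * k)) (λ i → Subset.∣ c i ∣) ≤ n * k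
odd-cycle-sizes zero k c per adj = ≤-reflexive
  (trans (Σ<-cong (suc (2 * k)) {g = λ _ → 0} (λ i _ → empty (c i))) (trans (sum-const (suc (2 * k)) 0) (*-zeroʳ (suc (2 * k)))))
  where
  empty : (S : Subset 0) → Subset.∣ S ∣ ≡ 0
  empty [] = refl
odd-cycle-sizes (suc n) k c per adj = begin
  Σ< D (λ i → Subset.∣ c i ∣)
    ≡⟨ Σ<-cong D (λ i _ → ∣∣-split (c i)) ⟩
  Σ< D (λ i → bit (Vec.head (c i)) + Subset.∣ Vec.tail (c i) ∣)
    ≡⟨ ∑-distrib-+ {D} (λ i → bit (Vec.head (c (toℕ i)))) (λ i → Subset.∣ Vec.tail (c (toℕ i)) ∣) ⟩
  Σ< D (λ i → bit (Vec.head (c i))) + Σ< D (λ i → Subset.∣ Vec.tail (c i) ∣)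
    ≤⟨ +-mono-≤
         (odd-cycle-bits k (Vec.head ∘ c) (cong Vec.head per) λ i → disjoint-heads (c i) (c (suc i)) (adj i))
         (odd-cycle-sizes n k (Vec.tail ∘ c) (cong Vec.tail per) λ i → disjoint-tails (c i) (c (suc i)) (adj i)) ⟩
  k + n * k ∎
  where
  open ≤-Reasoning
  D = suc (2 * k)

largeSets : ∀ n → ℕ → Family n
largeSets zero    zero    = [] List.∷ List.[]
largeSets zero    (suc s) = List.[]
largeSets (suc n) s = map (true ∷_) (largeSets n (pred s)) List.++ map (false ∷_) (largeSets n s)

largeSets-unique : ∀ n s → Unique (largeSets n s)
largeSets-unique zero    zero    = All.[] ∷ []
largeSets-unique zero    (suc s) = []
largeSets-unique (suc n) s = Unique.++⁺
  (Unique.map⁺ Vec.∷-injectiveʳ (largeSets-unique n (pred s)))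
  (Unique.map⁺ Vec.∷-injectiveʳ (largeSets-unique n s))
  λ (x∈t , x∈f) → heads-differ (∈-map⁻ (true ∷_) x∈t) (∈-map⁻ (false ∷_) x∈f)
  where
  heads-differ : ∀ {S : Subset (suc n)} {F F′ : Family n} →
    ∃ (λ S′ → S′ ∈ F × S ≡ true ∷ S′) → ∃ (λ S′ → S′ ∈ F′ × S ≡ false ∷ S′) → ⊥
  heads-differ (_ , _ , refl) (_ , _ , ())

largeSets-size : ∀ n s → All.All (λ S → s ≤ Subset.∣ S ∣) (largeSets n s)
largeSets-size zero    zero    = z≤n All.∷ All.[]
largeSets-size zero    (suc s) = All.[]
largeSets-size (suc n) s = All.++⁺
  (All.map⁺ (All.map (λ {S} → grow s {Subset.∣ S ∣}) (largeSets-size n (pred s))))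
  (All.map⁺ (largeSets-size n s))
  where
  grow : ∀ s {m} → pred s ≤ m → s ≤ suc m
  grow zero    _ = z≤n
  grow (suc s) p = s≤s p

-- An exact count, so that the family misses no more than the binomial sum. The recursion of
-- `largeSets` mirrors Pascal's rule, with `pred s` as the threshold once an element has been taken.
largeSets-length : ∀ n s → length (largeSets n s) + Σ< s (n C_) ≡ 2 ^ n
largeSets-length zero zero = refl
largeSets-length zero (suc s) = cong suc (trans (sum-const s 0) (*-zeroʳ s))
largeSets-length (suc n) s = begin
  length (largeSets (suc n) s) + Σ< s (suc n C_)
    ≡⟨ cong₂ _+_ split (pascal s) ⟩
  length (largeSets n (pred s)) + length (largeSets n s) + (Σ< (pred s) (n C_) + Σ< s (n C_))
    ≡⟨ lem (length (largeSets n (pred s))) (length (largeSets n s)) _ _ ⟩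
  length (largeSets n (pred s)) + Σ< (pred s) (n C_) + (length (largeSets n s) + Σ< s (n C_))
    ≡⟨ cong₂ _+_ (largeSets-length n (pred s)) (trans (largeSets-length n s) (sym (+-identityʳ _))) ⟩
  2 ^ suc n ∎
  where
  open ≡-Reasoning
  lem : ∀ a b c d → a + b + (c + d) ≡ a + c + (b + d)
  lem = solve-∀
  split : length (largeSets (suc n) s) ≡ length (largeSets n (pred s)) + length (largeSets n s)
  split = trans (List.length-++ (map (true ∷_) (largeSets n (pred s))))
    (cong₂ _+_ (List.length-map _ (largeSets n (pred s))) (List.length-map _ (largeSets n s)))
  lem′ : ∀ x y → 1 + (x + y) ≡ x + (1 + y)
  lem′ = solve-∀
  pascal : ∀ s → Σ< s (suc n C_) ≡ Σ< (pred s) (n C_) + Σ< s (n C_)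
  pascal zero    = refl
  pascal (suc s) = begin
    1 + Σ< s (λ i → suc n C suc i)                   ≡⟨ cong (1 +_) (Σ<-cong s (λ i _ → nCk+nC[k+1]≡[n+1]C[k+1] n i)) ⟨
    1 + Σ< s (λ i → n C i + n C suc i)               ≡⟨ cong (1 +_) (∑-distrib-+ {s} (λ i → n C toℕ i) (λ i → n C suc (toℕ i))) ⟩
    1 + (Σ< s (n C_) + Σ< s (λ i → n C suc i))       ≡⟨ lem′ (Σ< s (n C_)) _ ⟩
    Σ< s (n C_) + (1 + Σ< s (λ i → n C suc i))       ∎

-- The 2k+1 members of a cycle would have total size at least (2k+1)s > kn, against
-- `odd-cycle-sizes`.
large-oddCycleFree : ∀ {n} k s → k * n < suc (2 * k) * s → OddCycleFree k (largeSets n s)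
large-oddCycleFree {n} k s kn<Ds = largeSets-unique n s , no-cycle
  where
  open ≤-Reasoning
  D = suc (2 * k)
  no-cycle : ¬ ContainsCycle (2 * k) (largeSets n s)
  no-cycle (c , _ , c∈ , disj) = <⇒≱ kn<Ds (begin
    D * s                            ≡⟨ sum-const D s ⟨
    Σ< D (λ _ → s)                   ≤⟨ Σ<-mono D (λ i _ → All.lookup (largeSets-size n s) (c∈ (i mod D))) ⟩
    Σ< D (λ i → Subset.∣ c (i mod D) ∣) ≤⟨ odd-cycle-sizes n k (λ i → c (i mod D)) wrap step ⟩
    n * k                            ≡⟨ *-comm n k ⟩
    k * n                            ∎)
    where
    toℕ-mod : ∀ i → toℕ (i mod D) ≡ i % D
    toℕ-mod i = toℕ-fromℕ< (m%n<n i D)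
    wrap : c (D mod D) ≡ c (0 mod D)
    wrap = cong c (toℕ-injective (trans (toℕ-mod D) (trans (n%n≡0 D) (sym (toℕ-mod 0)))))
    step : ∀ i → Empty (c (i mod D) ∩ c (suc i mod D))
    step i = disj (i mod D) (suc i mod D) (begin-equality
      toℕ (suc i mod D)          ≡⟨ toℕ-mod (suc i) ⟩
      (1 + i) % D                ≡⟨ [m+n%d]%d≡[m+n]%d 1 i D ⟨
      suc (i % D) % D            ≡⟨ cong (λ z → suc z % D) (toℕ-mod i) ⟨
      suc (toℕ (i mod D)) % D    ∎)

-- The upper bound and the order of the deficit

-- Each level i below the cutoff is charged to level i+m: `C-shift` gains the factor 2k+1 that
-- `level-missing` loses, so C(n,i) is at most the number of missing sets of size i+m. Different i
-- use different levels, hence the complement is at least as large as the lower binomial sum.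
upper-bound : ∀ k n m → 1 ≤ k → LogBound k m → (F : Family n) → OddCycleFree k F →
  length F ≤ binomSum n (ceilDivSuc (k * n) (2 * k) ∸ m) n
upper-bound k n m 1≤k lb F free = subst (length F ≤_) (sym (sumRange≡Σ< (n C_) s n))
  (+-cancelʳ-≤ (Σ< s (n C_)) _ _ (begin
    length F + Σ< s (n C_)               ≤⟨ +-monoʳ-≤ (length F) (low s refl) ⟩
    length F + Σ< (suc n) μ              ≤⟨ length+missing≤ (proj₁ free) ⟩
    2 ^ n                                ≡⟨ Σ<-C n ⟨
    Σ< (suc n) (n C_)                    ≡⟨ cong (λ z → Σ< z (n C_)) (m+[n∸m]≡n (≤-trans (m∸n≤m c m) c≤1+n)) ⟨
    Σ< (s + (suc n ∸ s)) (n C_)          ≡⟨ Σ<-split s (suc n ∸ s) (n C_) ⟩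
    Σ< s (n C_) + Σ< (suc n ∸ s) (λ i → n C (s + i)) ≡⟨ +-comm (Σ< s (n C_)) _ ⟩
    Σ< (suc n ∸ s) (λ i → n C (s + i)) + Σ< s (n C_) ∎))
  where
  open ≤-Reasoning
  instance
    k≢0 : NonZero k
    k≢0 = >-nonZero 1≤k
  D = suc (2 * k)
  c = ceilDivSuc (k * n) (2 * k)
  s = c ∸ m
  μ : ℕ → ℕ
  μ a = levelSum n a (missing F)
  c≤1+n : c ≤ suc n
  c≤1+n = <⇒≤ (m<n*o⇒m/o<n (begin-strict
    k * n + 2 * k                            <⟨ m<m+n _ (s≤s z≤n) ⟩
    k * n + 2 * k + suc (n * suc k)          ≡⟨ lem k n ⟩
    suc n * D                                ∎))
    where
    lem : ∀ k n → k * n + 2 * k + suc (n * suc k) ≡ suc n * suc (2 * k)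
    lem = solve-∀
  level : ∀ i → i + m < c → n C i ≤ μ (i + m)
  level i i+m<c = *-cancelˡ-≤ D (≤-trans (C-shift k n i m 1≤k lb Da≤kn)
    (level-missing F free 1≤k (≤-trans 1≤k k≤a) D≤n Da≤kn))
    where
    k≤a : k ≤ i + m
    k≤a = ≤-trans (logBound⇒k≤m k m 1≤k lb) (m≤n+m m i)
    lem : ∀ k x → suc x + 2 * k ≡ suc (2 * k) + x
    lem = solve-∀
    -- An integer below the ceiling of kn/D is below kn/D itself; the 2k in the definition of the
    -- ceiling cancels against D - 1.
    Da≤kn : D * (i + m) ≤ k * n
    Da≤kn = <⇒≤ (+-cancelʳ-≤ (2 * k) _ _ (begin
      suc (D * (i + m)) + 2 * k   ≡⟨ lem k (D * (i + m)) ⟩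
      D + D * (i + m)             ≡⟨ *-suc D (i + m) ⟨
      D * suc (i + m)             ≤⟨ *-monoʳ-≤ D i+m<c ⟩
      D * c                       ≡⟨ *-comm D c ⟩
      c * D                       ≤⟨ m/n*n≤m (k * n + 2 * k) D ⟩
      k * n + 2 * k               ∎))
    D≤n : D ≤ n
    D≤n = *-cancelˡ-≤ k (≤-trans (≤-reflexive (*-comm k D)) (≤-trans (*-monoʳ-≤ D k≤a) Da≤kn))
  -- For s = 0 the sum is empty. For s > 0 the difference `c ∸ m` was not truncated, so s + m = c.
  low : ∀ s′ → s′ ≡ s → Σ< s′ (n C_) ≤ Σ< (suc n) μ
  low zero     _  = z≤n
  low s′@(suc _) eq = begin
    Σ< s′ (n C_)                ≤⟨ Σ<-mono s′ (λ i i<s → ≤-trans (level i (≤-trans (+-monoˡ-≤ m i<s) (≤-reflexive s+m≡c))) (≤-reflexive (cong μ (+-comm i m)))) ⟩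
    Σ< s′ (λ i → μ (m + i))     ≤⟨ Σ<-suffix m μ ⟩
    Σ< (m + s′) μ               ≤⟨ Σ<-prefix μ (≤-trans (≤-reflexive (trans (+-comm m s′) s+m≡c)) c≤1+n) ⟩
    Σ< (suc n) μ                ∎
    where
    s+m≡c : s′ + m ≡ c
    s+m≡c = trans (cong (_+ m) eq) (m∸n+n≡m {c} {m} (<⇒≤ (m∸n≢0⇒n<m {c} {m} λ s≡0 → 1+n≢0 (trans eq s≡0))))

deficit : ∀ k n → 1 ≤ k → suc (2 * k) ≤ n → (F : Family n) → OddCycleFree k F →
  binomSum n 0 (floorDivSuc (k * n) (2 * k)) ≤ 2 * suc (2 * k) * (2 ^ n ∸ length F)
deficit k n 1≤k D≤n F free = begin
  binomSum n 0 t                            ≡⟨ sumRange≡Σ< (n C_) 0 t ⟩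
  -- The averaging needs nonempty sets, so the term for size 0 is paid for separately, by level 1.
  -- This doubles the constant.
  1 + Σ< t (λ i → n C suc i)                ≤⟨ +-mono-≤ first rest ⟩
  D * Σ< (suc n) μ + D * Σ< (suc n) μ       ≡⟨ lem D (Σ< (suc n) μ) ⟩
  2 * D * Σ< (suc n) μ                      ≤⟨ *-monoʳ-≤ (2 * D) (m+n≤o⇒n≤o∸m (length F) (length+missing≤ (proj₁ free))) ⟩
  2 * D * (2 ^ n ∸ length F)                ∎
  where
  open ≤-Reasoning
  D = suc (2 * k)
  t = floorDivSuc (k * n) (2 * k)
  μ : ℕ → ℕ
  μ a = levelSum n a (missing F)
  lem : ∀ D x → D * x + D * x ≡ 2 * D * x
  lem = solve-∀
  m+n≤o⇒n≤o∸m : ∀ m {n o} → m + n ≤ o → n ≤ o ∸ m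
  m+n≤o⇒n≤o∸m m {n} p = m+n≤o⇒m≤o∸n n (≤-trans (≤-reflexive (+-comm n m)) p)
  Dt≤kn : D * t ≤ k * n
  Dt≤kn = ≤-trans (≤-reflexive (*-comm D t)) (m/n*n≤m (k * n) D)
  1≤n : 1 ≤ n
  1≤n = ≤-trans (s≤s z≤n) D≤n
  level : ∀ a → 1 ≤ a → D * a ≤ k * n → n C a ≤ D * μ a
  level a 1≤a = level-missing F free 1≤k 1≤a D≤n
  t≤n : t ≤ n
  t≤n = <⇒≤ (m<n*o⇒m/o<n (begin-strict
    k * n                      <⟨ m<m+n (k * n) (≤-trans 1≤n (m≤m+n n (k * n))) ⟩
    k * n + (n + k * n)        ≡⟨ lem₂ k n ⟩
    n * D                      ∎))
    where
    lem₂ : ∀ k n → k * n + (n + k * n) ≡ n * suc (2 * k)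
    lem₂ = solve-∀
  first : 1 ≤ D * Σ< (suc n) μ
  first = begin
    1                   ≤⟨ 1≤n ⟩
    n                   ≡⟨ nC1≡n n ⟨
    n C 1               ≤⟨ level 1 ≤-refl (≤-trans (≤-reflexive (*-identityʳ D)) (≤-trans D≤n (m≤n*m n k {{>-nonZero 1≤k}}))) ⟩
    D * μ 1             ≤⟨ *-monoʳ-≤ D (≤-trans (≤-trans (m≤n+m (μ 1) (μ 0)) (≤-reflexive (cong (μ 0 +_) (sym (+-identityʳ (μ 1)))))) (Σ<-prefix μ (s≤s 1≤n))) ⟩
    D * Σ< (suc n) μ    ∎
  rest : Σ< t (λ i → n C suc i) ≤ D * Σ< (suc n) μ
  rest = begin
    Σ< t (λ i → n C suc i)    ≤⟨ Σ<-mono t (λ i i<t → level (suc i) (s≤s z≤n) (≤-trans (*-monoʳ-≤ D i<t) Dt≤kn)) ⟩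
    Σ< t (λ i → D * μ (suc i)) ≡⟨ Σ<-*ˡ t D (μ ∘ suc) ⟨
    D * Σ< t (μ ∘ suc)        ≤⟨ *-monoʳ-≤ D (≤-trans (Σ<-suffix 1 {t} μ) (Σ<-prefix {suc t} {suc n} μ (s≤s t≤n))) ⟩
    D * Σ< (suc n) μ          ∎

theorem4 : (k : ℕ) → 1 ≤ k →
    ((n m : ℕ) → LogBound k m → (F : Family n) → OddCycleFree k F →
    length F ≤ binomSum n (ceilDivSuc (k * n) (2 * k) ∸ m) n)
    × (∃₂ λ a b → ∃ λ n₀ → (n : ℕ) → n₀ ≤ n →
    ((F : Family n) → OddCycleFree k F →
    binomSum n 0 (floorDivSuc (k * n) (2 * k)) ≤ a * (2 ^ n ∸ length F))
    × (∃ λ (F : Family n) → OddCycleFree k F ×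
    2 ^ n ≤ length F + b * binomSum n 0 (floorDivSuc (k * n) (2 * k))))
theorem4 k 1≤k =
  (λ n m lb F free → upper-bound k n m 1≤k lb F free) ,
  -- `2 * D` is the constant of `deficit`, 1 suffices because the family of large sets misses
  -- exactly the binomial sum, and n ≥ D makes the cut points distinct. The size `suc (t n)` is the
  -- least integer above kn/(2k+1).
  2 * D , 1 , D , λ n D≤n →
    deficit k n 1≤k D≤n ,
    largeSets n (suc (t n)) ,
    large-oddCycleFree k (suc (t n)) (kn<D[1+t] n) ,
    ≤-reflexive (sym (trans
      (cong (length (largeSets n (suc (t n))) +_) (trans (*-identityˡ _) (sumRange≡Σ< (n C_) 0 (t n))))
      (largeSets-length n (suc (t n)))))
  where
  open ≤-Reasoning
  D = suc (2 * k)
  t = λ n → floorDivSuc (k * n) (2 * k)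
  kn<D[1+t] : ∀ n → k * n < D * suc (t n)
  kn<D[1+t] n = begin-strict
    k * n                        ≡⟨ m≡m%n+[m/n]*n (k * n) D ⟩
    k * n % D + t n * D          <⟨ +-monoˡ-< (t n * D) (m%n<n (k * n) D) ⟩
    suc (t n) * D                ≡⟨ *-comm (suc (t n)) D ⟩
    D * suc (t n)                ∎
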